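{- The outcome of the Maker-Breaker domination game on a tree (given as a starting position) can be decided in polynomial time.
   Context: The Maker-Breaker domination game on a graph: Dominator and Staller alternately choose a not-yet-chosen vertex (no passing), starting with all vertices unchosen; when all vertices are chosen, Dominator wins if his vertices form a dominating set of the graph, otherwise Staller wins. The outcome is $\mathcal D$ if Dominator has a winning strategy both as first and as second player, $\mathcal S$ if Staller has a winning strategy both as first and as second player, and $\mathcal N$ if the first player has a winning strategy; every graph has one of these three outcomes. -}

module Defs where

open import Data.Bool.Base using (Bool; true; false)
open import Data.Fin.Base using (Fin)
open import Data.List.Base as List using (List; []; _∷_; _∷ʳ_; length; concat; tabulate)
open import Data.List.Relation.Unary.Linked using (Linked)
open import Data.List.Relation.Unary.Unique.Propositional using (Unique)
open import Data.Maybe.Base using (Maybe; just; nothing)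
open import Data.Nat.Base using (ℕ; zero; suc; _+_; _*_; _≤_)
open import Data.Product.Base using (∃; _×_; _,_)
open import Data.Sum.Base using (_⊎_; inj₁; inj₂)
open import Data.Vec.Base as Vec using (Vec; _∷_; lookup; replicate; _[_]≔_; zipWith)
open import Function.Bundles using (_↔_)
open import Relation.Binary.Construct.Closure.ReflexiveTransitive using (Star)
open import Relation.Binary.PropositionalEquality.Core using (_≡_; _≢_)
open import Relation.Nullary.Negation.Core using (¬_)

record Graph (n : ℕ) : Set where
  field
    adj        : Fin n → Fin n → Bool
    adj-sym    : ∀ u v → adj u v ≡ adj v u
    adj-irrefl : ∀ v → adj v v ≡ false

  _~_ : Fin n → Fin n → Set
  u ~ v = adj u v ≡ true

module _ {n : ℕ} (G : Graph n) where
  open Graph G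

  Connected : Set
  Connected = ∀ u v → Star _~_ u v

  -- The cycle v , vs₀ , … , vsₖ , v, which has at least three distinct vertices.
  record IsCycle (v : Fin n) (vs : List (Fin n)) : Set where
    field
      closed-walk : Linked _~_ (v ∷ (vs ∷ʳ v))
      distinct    : Unique (v ∷ vs)
      long        : 2 ≤ length vs

  record IsTree : Set where
    field
      nonempty  : 1 ≤ n
      connected : Connected
      acyclic   : ∀ v vs → ¬ IsCycle v vs

  IsDominatingSet : (Fin n → Set) → Set
  IsDominatingSet D = ∀ v → ∃ λ u → D u × (u ≡ v ⊎ u ~ v)

data Player : Set where
  dominator staller : Player

opponent : Player → Player
opponent dominator = staller
opponent staller   = dominator

Position : ℕ → Set
Position n = Vec (Maybe Player) n

start : ∀ {n} → Position n
start = replicate _ nothing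

module _ {n : ℕ} where

  Unchosen : Position n → Fin n → Set
  Unchosen pos v = lookup pos v ≡ nothing

  ChosenBy : Player → Position n → Fin n → Set
  ChosenBy P pos v = lookup pos v ≡ just P

  Over : Position n → Set
  Over pos = ∀ v → ¬ Unchosen pos v

  choose : Player → Fin n → Position n → Position n
  choose P v pos = pos [ v ]≔ just P

module _ {n : ℕ} (G : Graph n) where

  WinsAtEnd : Player → Position n → Set
  WinsAtEnd dominator pos = IsDominatingSet G (ChosenBy dominator pos)
  WinsAtEnd staller   pos = ¬ IsDominatingSet G (ChosenBy dominator pos)

  -- Winning strategies for P, as game trees: one move at each turn of P, a
  -- continuation for every possible move at each turn of the opponent, and a
  -- win for P at every leaf.  Leaves occur only when all vertices are chosen
  -- (hence the first premise of  reply ).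
  data WinningStrategy (P : Player) (turn : Player) (pos : Position n) : Set where
    end   : Over pos → WinsAtEnd P pos → WinningStrategy P turn pos
    move  : turn ≡ P →
            (v : Fin n) → Unchosen pos v →
            WinningStrategy P (opponent turn) (choose turn v pos) →
            WinningStrategy P turn pos
    reply : ∃ (Unchosen pos) → turn ≢ P →
            (∀ v → Unchosen pos v →
              WinningStrategy P (opponent turn) (choose turn v pos)) →
            WinningStrategy P turn pos

  HasWinningStrategy : (P first : Player) → Set
  HasWinningStrategy P first = WinningStrategy P first start

data Outcome : Set where
  𝓓 𝓢 𝓝 : Outcome

HasOutcome : ∀ {n} → Graph n → Outcome → Set
HasOutcome G 𝓓 = ∀ first → HasWinningStrategy G dominator first
HasOutcome G 𝓢 = ∀ first → HasWinningStrategy G staller first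
HasOutcome G 𝓝 = ∀ first → HasWinningStrategy G first first

Finite : Set → Set
Finite A = ∃ λ n → A ↔ Fin n

data Direction : Set where
  left right stay : Direction

data Symbol (Input Work : Set) : Set where
  blank : Symbol Input Work
  input : Input → Symbol Input Work
  work  : Work → Symbol Input Work

-- A two-way infinite tape, blank outside the listed cells; both lists start
-- with the cell next to the head.
record Tape (Input Work : Set) : Set where
  constructor tape
  field
    before : List (Symbol Input Work)
    head   : Symbol Input Work
    after  : List (Symbol Input Work)

module _ {Input Work : Set} where

  write : Symbol Input Work → Tape Input Work → Tape Input Work
  write s (tape ls _ rs) = tape ls s rs

  shift : Direction → Tape Input Work → Tape Input Work
  shift left  (tape []       s rs)       = tape [] blank (s ∷ rs)
  shift left  (tape (l ∷ ls) s rs)       = tape ls l (s ∷ rs)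
  shift right (tape ls       s [])       = tape (s ∷ ls) blank []
  shift right (tape ls       s (r ∷ rs)) = tape (s ∷ ls) r rs
  shift stay  t                          = t

  act : Symbol Input Work × Direction → Tape Input Work → Tape Input Work
  act (s , d) t = shift d (write s t)

  emptyTape : Tape Input Work
  emptyTape = tape [] blank []

  inputTape : List Input → Tape Input Work
  inputTape []       = emptyTape
  inputTape (x ∷ xs) = tape [] (input x) (List.map input xs)

-- Deterministic and multitape; the input is on the first tape, the others are
-- blank.  The result is given by the halting state: besides the working states there
-- is one halting state for each element of Output (as accept / reject for
-- decision problems).
record TuringMachine (Input Output : Set) : Set₁ where
  field
    State        : Set
    State-finite : Finite State
    Work         : Set
    Work-finite  : Finite Work
    extraTapes   : ℕ
    initial      : State

  tapes : ℕ
  tapes = suc extraTapes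

  field
    δ : State → Vec (Symbol Input Work) tapes →
        (State ⊎ Output) × Vec (Symbol Input Work × Direction) tapes

module _ {Input Output : Set} (M : TuringMachine Input Output) where
  open TuringMachine M

  record Configuration : Set where
    constructor config
    field
      control  : State ⊎ Output
      contents : Vec (Tape Input Work) tapes

  step : Configuration → Configuration
  step (config (inj₂ o) ts) = config (inj₂ o) ts
  step (config (inj₁ q) ts) =
    let q′ , actions = δ q (Vec.map Tape.head ts)
    in config q′ (zipWith act actions ts)

  run : ℕ → Configuration → Configuration
  run zero    c = c
  run (suc t) c = run t (step c)

  initialConfiguration : List Input → Configuration
  initialConfiguration w = config (inj₁ initial) (inputTape w ∷ replicate _ emptyTape)

  -- Halting configurations are fixed by  step , so this means: halts after at
  -- most t steps, with result o.
  OutputsWithin : ℕ → List Input → Output → Set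
  OutputsWithin t w o =
    Configuration.control (run t (initialConfiguration w)) ≡ inj₂ o

-- Coefficients, constant term first.
Polynomial : Set
Polynomial = List ℕ

evaluate : Polynomial → ℕ → ℕ
evaluate []       x = 0
evaluate (a ∷ as) x = a + x * evaluate as x

data InputSymbol : Set where
  bit       : Bool → InputSymbol
  separator : InputSymbol

-- The adjacency matrix row by row, each row followed by a separator.
encode : ∀ {n} → Graph n → List InputSymbol
encode G = concat (tabulate λ u → tabulate (λ v → bit (adj u v)) ∷ʳ separator)
  where open Graph G

{-# OPTIONS --safe #-}

-- Peel the tree: repeatedly take a fresh vertex with at most one fresh neighbour (its
-- parent) and label it from the labels of its children, the neighbours labelled before it.
--   two or more needy children             flexible
--   exactly one needy child                matched   (with that child)
--   no needy child, some flexible child    flexible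
--   only matched children                  needy
-- An obstacle is a vertex with two needy children, or a needy vertex without parent; the
-- outcome is 𝓓, 𝓝 or 𝓢 according to whether there are no, one or several obstacles.
--
-- Staller wins when he moves first in the untouched part below an obstacle: bottom-up, he
-- plays each matched vertex, which forces Dominator to answer at its needy child, and then
-- the obstacle itself, which captures it or threatens two needy children at once.  The
-- parts below distinct obstacles are disjoint, so with two obstacles Dominator's first move
-- spoils at most one of them.  If there is at most one obstacle and Dominator owns it, he
-- wins by pairing matched vertices with their needy children, and the flexible vertices,
-- which form a path starting at the obstacle, alternately from the top of this path.
--
-- A three-tape machine performs one peeling step per round: the second tape holds the
-- labels in step with the columns of the row being read, and on the third one, also
-- holding the labels, the head stays at the vertex of that row.

module Submission where

open import Defs
open import Data.Bool.Base using (Bool; true; false; not; _∧_; if_then_else_)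
open import Data.Bool.Properties as Bool using ()
open import Data.Fin.Base using (Fin; zero; suc)
open import Data.Fin.Patterns using (0F; 1F; 2F; 3F)
open import Data.Fin.Properties as Fin using (any?; +↔⊎; *↔×)
open import Data.List.Base as List using (List; []; _∷_; _++_; _∷ʳ_; _ʳ++_; length; concat; tabulate)
open import Data.List.Membership.Propositional using (_∈_)
open import Data.List.Membership.Propositional.Properties using (∈-∃++; ∈-lookup)
open import Data.List.Properties using (++-identityʳ; ∷ʳ-++; ʳ++-ʳ++; reverse-involutive; length-++; length-ʳ++; length-reverse; length-tabulate)
open import Data.List.Relation.Unary.All as All using ([]; _∷_)
open import Data.List.Relation.Unary.All.Properties as All using (¬Any⇒All¬; ++⁻ˡ)
open import Data.List.Relation.Unary.AllPairs using ([]; _∷_)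
open import Data.List.Relation.Unary.Any as Any using ()
open import Data.List.Relation.Unary.Linked using (Linked; [-]; _∷_)
open import Data.List.Relation.Unary.Unique.Propositional using (Unique)
open import Data.Maybe.Base using (Maybe; just; nothing)
open import Data.Maybe.Properties using (just-injective)
open import Data.Nat.Base using (ℕ; zero; suc; _+_; _*_; _∸_; _≤_; _<_; z≤n; s≤s)
open import Data.Nat.Properties as ℕ using ()
open import Data.Nat.Solver using (module +-*-Solver)
open import Data.Product.Base using (Σ; ∃; _×_; _,_; proj₁; proj₂)
open import Data.Product.Function.NonDependent.Propositional using (_×-↔_)
open import Data.Sum.Base using (_⊎_; inj₁; inj₂; swap)
open import Data.Sum.Function.Propositional using (_⊎-↔_)
open import Data.Unit.Base using (⊤; tt)
open import Data.Vec.Base using (Vec; []; _∷_; lookup)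
open import Data.Vec.Functional using (updateAt)
open import Data.Vec.Functional.Properties using (updateAt-updates; updateAt-minimal)
open import Data.Vec.Properties using (lookup∘update; lookup∘update′; lookup-replicate)
open import Function.Base using (_∘_; case_of_; const)
open import Function.Bundles using (_↔_; mk↔ₛ′)
open import Function.Construct.Composition using (_↔-∘_)
open import Function.Construct.Identity using (↔-id)
open import Function.Construct.Symmetry using (↔-sym)
open import Function.Properties.Inverse using (↔⇒↣)
open import Relation.Binary.Construct.Closure.ReflexiveTransitive using (Star; ε; _◅_; _◅◅_)
open import Relation.Binary.Definitions using (DecidableEquality; tri<; tri≈; tri>)
open import Relation.Binary.PropositionalEquality using (_≡_; _≢_; refl; sym; trans; cong; cong₂; subst; module ≡-Reasoning)
open import Relation.Nullary using (¬_; Dec; yes; no; contradiction; does)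
open import Relation.Nullary.Decidable using (_×-dec_; _⊎-dec_; map′; via-injection; dec-true; dec-false)

open +-*-Solver using (solve; con; _:+_; _:*_; _:=_)

-- Counting up to two

data Few : Set where
  none one many : Few

infixr 6 _⊕_

_⊕_ : Few → Few → Few
none ⊕ k    = k
one  ⊕ none = one
one  ⊕ one  = many
one  ⊕ many = many
many ⊕ k    = many

⊕-assoc : ∀ i j k → (i ⊕ j) ⊕ k ≡ i ⊕ j ⊕ k
⊕-assoc none j    k    = refl
⊕-assoc one  none k    = refl
⊕-assoc one  one  none = refl
⊕-assoc one  one  one  = refl
⊕-assoc one  one  many = refl
⊕-assoc one  many k    = refl
⊕-assoc many j    k    = refl

⊕-identityʳ : ∀ k → k ⊕ none ≡ k
⊕-identityʳ none = refl
⊕-identityʳ one  = refl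
⊕-identityʳ many = refl

Counts : {X : Set} → Few → (X → Set) → Set
Counts none P = ∀ x → ¬ P x
Counts one  P = ∃ λ x → P x × (∀ y → P y → y ≡ x)
Counts many P = ∃ λ x → ∃ λ y → x ≢ y × P x × P y

Counts-resp : ∀ {X : Set} {P Q : X → Set} → (∀ x → P x → Q x) → (∀ x → Q x → P x) →
              ∀ k → Counts k P → Counts k Q
Counts-resp to from none c                       x q = c x (from x q)
Counts-resp to from one  (x , p , unique)            = x , to x p , λ y q → unique y (from y q)
Counts-resp to from many (x , y , x≢y , p , p′)      = x , y , x≢y , to x p , to y p′

Counts-insert : ∀ {X : Set} {P : X → Set} {v} → ¬ P v →
                ∀ k → Counts k P → Counts (one ⊕ k) (λ x → P x ⊎ x ≡ v)
Counts-insert {v = v} ¬p none c = v , inj₂ refl , λ where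
  y (inj₁ p)  → contradiction p (c y)
  y (inj₂ eq) → eq
Counts-insert {v = v} ¬p one (x , p , _) =
  x , v , (λ { refl → ¬p p }) , inj₁ p , inj₂ refl
Counts-insert ¬p many (x , y , x≢y , p , p′) = x , y , x≢y , inj₁ p , inj₁ p′

Counts-≤1 : ∀ {X : Set} {P : X → Set} {k} → k ≢ many → Counts k P →
            ∀ {x y} → P x → P y → x ≡ y
Counts-≤1 {k = none} _ c            {x} p _ = contradiction p (c x)
Counts-≤1 {k = one}  _ (z , _ , unique) p q = trans (unique _ p) (sym (unique _ q))
Counts-≤1 {k = many} k≢many _           p q = contradiction refl k≢many

none≢many : ∀ {X : Set} {P : X → Set} → Counts none P → ¬ Counts many P
none≢many c (x , _ , _ , p , _) = c x p

one≢many : ∀ {X : Set} {P : X → Set} → Counts one P → ¬ Counts many P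
one≢many (_ , _ , unique) (x , y , x≢y , p , q) = x≢y (trans (unique x p) (sym (unique y q)))

indicator : Bool → Few
indicator false = none
indicator true  = one

tally : ∀ {m} → (Fin m → Bool) → Few
tally {zero}  f = none
tally {suc m} f = indicator (f zero) ⊕ tally (f ∘ suc)

Counts-tally : ∀ {m} (f : Fin m → Bool) → Counts (tally f) (λ j → f j ≡ true)
Counts-tally {zero}  f ()
Counts-tally {suc m} f with f zero in eq | tally (f ∘ suc) | Counts-tally (f ∘ suc)
... | false | none | c = λ where
  zero    p → contradiction (trans (sym eq) p) λ ()
  (suc j) p → c j p
... | false | one  | j , p , unique = suc j , p , λ where
  zero    q → contradiction (trans (sym eq) q) λ ()
  (suc i) q → cong suc (unique i q)
... | false | many | i , j , i≢j , p , q = suc i , suc j , i≢j ∘ Fin.suc-injective , p , q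
... | true  | none | c = zero , eq , λ where
  zero    q → refl
  (suc i) q → contradiction q (c i)
... | true  | one  | j , p , _ = zero , suc j , (λ ()) , eq , p
... | true  | many | j , _ , _ , p , _ = zero , suc j , (λ ()) , eq , p

-- Positions and strategies

-- Wrapped in records, so that the position can be inferred from the type.
record Vacant {n} (pos : Position n) (v : Fin n) : Set where
  constructor vacant
  field unchosen : Unchosen pos v

record Owns {n} (P : Player) (pos : Position n) (v : Fin n) : Set where
  constructor owns
  field chosen : ChosenBy P pos v

open Vacant
open Owns

module _ {n : ℕ} where

  vacant? : (pos : Position n) (v : Fin n) → Dec (Vacant pos v)
  vacant? pos v with lookup pos v in eq
  ... | nothing = yes (vacant eq)
  ... | just _  = no λ (vacant u) → contradiction (trans (sym eq) u) λ ()

  over-or-vacant : (pos : Position n) → Over pos ⊎ ∃ (Vacant pos)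
  over-or-vacant pos with any? (vacant? pos)
  ... | yes some    = inj₂ some
  ... | no  ∄vacant = inj₁ λ v u → ∄vacant (v , vacant u)

  start-vacant : ∀ v → Vacant (start {n}) v
  start-vacant v = vacant (lookup-replicate v nothing)

  module _ {pos : Position n} where

    owns-unique : ∀ {P Q v} → Owns P pos v → Owns Q pos v → P ≡ Q
    owns-unique (owns c) (owns c′) = just-injective (trans (sym c) c′)

    vacant≢owned : ∀ {P v w} → Vacant pos v → Owns P pos w → w ≢ v
    vacant≢owned (vacant u) (owns c) refl = contradiction (trans (sym u) c) λ ()

    choose-owns : ∀ {P} w → Owns P (choose P w pos) w
    choose-owns w = owns (lookup∘update w pos _)

    choose-vacant : ∀ {P v w} → v ≢ w → Vacant pos v → Vacant (choose P w pos) v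
    choose-vacant v≢w (vacant u) = vacant (trans (lookup∘update′ v≢w pos _) u)

    choose-preserves : ∀ {P Q v w} → Vacant pos w → Owns Q pos v → Owns Q (choose P w pos) v
    choose-preserves u o = owns (trans (lookup∘update′ (vacant≢owned u o) pos _) (chosen o))

-- The measure for building strategies: each move lowers it by one.
free : ∀ {n} → Position n → ℕ
free []              = 0
free (nothing ∷ pos) = suc (free pos)
free (just _  ∷ pos) = free pos

free-choose : ∀ {n} {pos : Position n} {P v} → Vacant pos v →
              free pos ≡ suc (free (choose P v pos))
free-choose {pos = pos} {v = v} (vacant u) = go pos v u
  where
  go : ∀ {n} (pos : Position n) {P} v → Unchosen pos v → free pos ≡ suc (free (choose P v pos))
  go (nothing ∷ pos) zero    u = refl
  go (nothing ∷ pos) (suc v) u = cong suc (go pos v u)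
  go (just _  ∷ pos) (suc v) u = go pos v u

module Game {n : ℕ} (G : Graph n) where
  open Graph G

  ~-sym : ∀ {u v} → u ~ v → v ~ u
  ~-sym {u} {v} p = trans (adj-sym v u) p

  ~⇒≢ : ∀ {u v} → u ~ v → u ≢ v
  ~⇒≢ {u} p refl = contradiction (trans (sym p) (adj-irrefl u)) λ ()

  move-to : ∀ {P pos} v → Vacant pos v → WinningStrategy G P (opponent P) (choose P v pos) →
            WinningStrategy G P P pos
  move-to v u = move refl v (unchosen u)

  -- `reply` wants an unchosen vertex as evidence that the game is not over. Splitting on the player
  -- lets `opponent` compute, which refutes the equality of turn and player.
  answering : ∀ {P pos} → ∃ (Vacant pos) →
              (∀ v → Vacant pos v → WinningStrategy G P P (choose (opponent P) v pos)) →
              WinningStrategy G P (opponent P) pos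
  answering {dominator} (v , u) f = reply (v , unchosen u) (λ ()) λ w u′ → f w (vacant u′)
  answering {staller}   (v , u) f = reply (v , unchosen u) (λ ()) λ w u′ → f w (vacant u′)

  Captured : Position n → Fin n → Set
  Captured pos v = ∀ u → u ≡ v ⊎ u ~ v → Owns staller pos u

  -- Dominator can no longer dominate a captured vertex, so Staller plays arbitrary vertices until
  -- the board is full.
  captured-wins : ∀ {pos turn} v → Captured pos v → WinningStrategy G staller turn pos
  captured-wins {pos} {turn} v = go (free pos) pos turn refl
    where
    go : ∀ k pos turn → free pos ≡ k → Captured pos v → WinningStrategy G staller turn pos
    go k pos turn eq captured with over-or-vacant pos
    ... | inj₁ over = end over λ dominating →
          let u , c , near = dominating v
          in  contradiction (owns-unique (owns c) (captured u near)) λ ()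
    go zero pos turn eq captured | inj₂ (w , u) =
      contradiction (trans (sym eq) (free-choose {P = staller} u)) λ ()
    go (suc k) pos staller eq captured | inj₂ (w , u) =
      move-to w u (go k _ dominator (ℕ.suc-injective (trans (sym (free-choose u)) eq))
                        λ x near → choose-preserves u (captured x near))
    go (suc k) pos dominator eq captured | inj₂ some =
      answering some λ w u → go k _ staller (ℕ.suc-injective (trans (sym (free-choose u)) eq))
                                     λ x near → choose-preserves u (captured x near)

  -- Pairing strategies for Dominator

  module Pairing
    (Pair : Fin n → Fin n → Set)
    (pair? : ∀ v w → Dec (Pair v w))
    (pair-sym : ∀ {v w} → Pair v w → Pair w v)
    (pair-unique : ∀ {v w w′} → Pair v w → Pair v w′ → w ≡ w′)
    where

    -- The invariant of the pairing strategy: a vertex is dominated already, or it will be because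
    -- Dominator gets the vertex itself or its partner, a neighbour.
    data Safe (pos : Position n) (v : Fin n) : Set where
      dominated : ∀ u → Owns dominator pos u → u ≡ v ⊎ u ~ v → Safe pos v
      paired    : ∀ w → Pair v w → w ~ v → Vacant pos v → Vacant pos w → Safe pos v

    safe-choose : ∀ {pos w} → Vacant pos w → ∀ v → Safe pos v → Safe (choose dominator w pos) v
    safe-choose {pos} uw v (dominated u o near) = dominated u (choose-preserves uw o) near
    safe-choose {pos} {w} uw v (paired x pair x~v uv ux) with v Fin.≟ w | x Fin.≟ w
    ... | yes refl | _        = dominated v (choose-owns {pos = pos} v) (inj₁ refl)
    ... | no  _    | yes refl = dominated x (choose-owns {pos = pos} x) (inj₂ x~v)
    ... | no  v≢w  | no  x≢w  =
      paired x pair x~v (choose-vacant v≢w uv) (choose-vacant x≢w ux)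

    safe-end : ∀ pos → (∀ v → Safe pos v) → Over pos → WinsAtEnd G dominator pos
    safe-end pos safe over v with safe v
    ... | dominated u o near = u , chosen o , near
    ... | paired _ _ _ u _   = contradiction (unchosen u) (over v)

    -- Dominator answers at the partner of `w` if this is vacant. Otherwise no vacant pair contains
    -- `w`, so Staller's move spoils nothing and the answer is arbitrary.
    safe-respond : ∀ pos w → Vacant pos w → (∀ v → Safe pos v) →
      (∃ λ x → Vacant (choose staller w pos) x ×
               (∀ v → Safe (choose dominator x (choose staller w pos)) v))
      ⊎ (∀ v → Safe (choose staller w pos) v)
    safe-respond pos w uw safe
      with any? (λ x → pair? w x ×-dec vacant? (choose staller w pos) x)
    ... | yes (x , pair , ux) = inj₁ (x , ux , safe′)
      where
      safe′ : ∀ v → Safe (choose dominator x (choose staller w pos)) v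
      safe′ v with safe v
      ... | dominated u o near =
        dominated u (choose-preserves ux (choose-preserves uw o)) near
      ... | paired y pair′ y~v uv uy with v Fin.≟ w | v Fin.≟ x
      ...   | yes refl | _ rewrite pair-unique pair pair′ =
        dominated y (choose-owns {pos = choose staller w pos} y) (inj₂ y~v)
      ...   | no _     | yes refl =
        dominated x (choose-owns {pos = choose staller w pos} x) (inj₁ refl)
      ...   | no v≢w   | no v≢x   = paired y pair′ y~v
        (choose-vacant v≢x (choose-vacant v≢w uv))
        (choose-vacant (λ { refl → v≢w (pair-unique (pair-sym pair′) (pair-sym pair)) })
            (choose-vacant (λ { refl → v≢x (pair-unique (pair-sym pair′) pair) }) uy))
    ... | no unpaired = inj₂ safe′
      where
      safe′ : ∀ v → Safe (choose staller w pos) v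
      safe′ v with safe v
      ... | dominated u o near = dominated u (choose-preserves uw o) near
      ... | paired y pair y~v uv uy = paired y pair y~v
        (choose-vacant (λ { refl → unpaired (y , pair , choose-vacant (~⇒≢ y~v) uy) }) uv)
        (choose-vacant (λ { refl → unpaired (v , pair-sym pair ,
            choose-vacant (~⇒≢ (~-sym y~v)) uv) }) uy)

    -- One unit of `k` pays for a move of Staller and its answer, which together lower `free` by
    -- two; hence the bound is an inequality.
    safe-wins : ∀ pos → (∀ v → Safe pos v) → WinningStrategy G dominator staller pos
    safe-wins pos = go (free pos) pos ℕ.≤-refl
      where
      go : ∀ k pos → free pos ≤ k → (∀ v → Safe pos v) → WinningStrategy G dominator staller pos
      go k pos bound safe with over-or-vacant pos
      ... | inj₁ over = end over (safe-end pos safe over)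
      go zero pos bound safe | inj₂ (w , u) =
        contradiction (subst (_≤ 0) (free-choose {P = staller} u) bound) λ ()
      go (suc k) pos bound safe | inj₂ some = answering some answer
        where
        answer : ∀ w → Vacant pos w → WinningStrategy G dominator dominator (choose staller w pos)
        answer w uw = case safe-respond pos w uw safe of λ where
            (inj₁ (x , ux , safe′)) → move-to x ux (go k _ (bound′ ux) safe′)
            (inj₂ safe′) → case over-or-vacant (choose staller w pos) of λ where
              (inj₁ over)     → end over (safe-end _ safe′ over)
              (inj₂ (x , ux)) → move-to x ux (go k _ (bound′ ux) λ v → safe-choose ux v (safe′ v))
          where
          bound′ : ∀ {x} → Vacant (choose staller w pos) x →
                   free (choose dominator x (choose staller w pos)) ≤ k
          bound′ {x} ux = ℕ.≤-trans (ℕ.n≤1+n _) (subst (_≤ k) (free-choose ux)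
                            (ℕ.≤-pred (subst (_≤ suc k) (free-choose uw) bound)))

    safe-wins-first : ∀ pos → (∀ v → Safe pos v) → WinningStrategy G dominator dominator pos
    safe-wins-first pos safe with over-or-vacant pos
    ... | inj₁ over    = end over (safe-end pos safe over)
    ... | inj₂ (w , u) = move-to w u (safe-wins _ λ v → safe-choose u v (safe v))

-- Peeling

data Label : Set where
  fresh matched needy flexible : Label

Label↔Fin : Label ↔ Fin 4
Label↔Fin = mk↔ₛ′
  (λ { fresh → 0F ; matched → 1F ; needy → 2F ; flexible → 3F })
  (λ { 0F → fresh ; 1F → matched ; 2F → needy ; 3F → flexible })
  (λ { 0F → refl ; 1F → refl ; 2F → refl ; 3F → refl })
  (λ { fresh → refl ; matched → refl ; needy → refl ; flexible → refl })

_≟ᴸ_ : DecidableEquality Label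
_≟ᴸ_ = via-injection (↔⇒↣ Label↔Fin) Fin._≟_

is : Label → Label → Bool
is a b = does (b ≟ᴸ a)

does-true : ∀ {X : Set} (x? : Dec X) → does x? ≡ true → X
does-true (yes x) _ = x

-- The numbers of fresh, needy and flexible neighbours of a vertex.
Tally : Set
Tally = Few × Few × Few

-- The first argument is the number of obstacles found so far.
decide : Few → Tally → Label → Maybe (Label × Few)
decide g (many , _    , _   ) fresh = nothing
decide g (none , many , _   ) fresh = just (flexible , one ⊕ g)
decide g (one  , many , _   ) fresh = just (flexible , one ⊕ g)
decide g (none , one  , _   ) fresh = just (matched , g)
decide g (one  , one  , _   ) fresh = just (matched , g)
decide g (none , none , none) fresh = just (needy , one ⊕ g)
decide g (one  , none , none) fresh = just (needy , g)
decide g (none , none , _   ) fresh = just (flexible , g)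
decide g (one  , none , _   ) fresh = just (flexible , g)
decide g _                    _     = nothing

-- The table of `decide` condensed to the five reasons for giving a label; only `cherry` and
-- `isolated` create an obstacle.
data Rule (g : Few) : Tally → Label → Few → Set where
  cherry   : ∀ {f c} → Rule g (f , many , c) flexible (one ⊕ g)
  match    : ∀ {f c} → Rule g (f , one , c) matched g
  relay    : ∀ {f c} → c ≢ none → Rule g (f , none , c) flexible g
  isolated : Rule g (none , none , none) needy (one ⊕ g)
  hang     : Rule g (one , none , none) needy g

decide-rule : ∀ g t x {ℓ g′} → decide g t x ≡ just (ℓ , g′) →
              x ≡ fresh × proj₁ t ≢ many × Rule g t ℓ g′
decide-rule g (none , none , none) fresh refl = refl , (λ ()) , isolated
decide-rule g (none , none , one ) fresh refl = refl , (λ ()) , relay λ ()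
decide-rule g (none , none , many) fresh refl = refl , (λ ()) , relay λ ()
decide-rule g (none , one  , c   ) fresh refl = refl , (λ ()) , match
decide-rule g (none , many , c   ) fresh refl = refl , (λ ()) , cherry
decide-rule g (one  , none , none) fresh refl = refl , (λ ()) , hang
decide-rule g (one  , none , one ) fresh refl = refl , (λ ()) , relay λ ()
decide-rule g (one  , none , many) fresh refl = refl , (λ ()) , relay λ ()
decide-rule g (one  , one  , c   ) fresh refl = refl , (λ ()) , match
decide-rule g (one  , many , c   ) fresh refl = refl , (λ ()) , cherry
decide-rule g (many , b    , c   ) fresh    ()
decide-rule g (many , b    , c   ) matched  ()
decide-rule g (many , b    , c   ) needy    ()
decide-rule g (many , b    , c   ) flexible ()

decide-nothing : ∀ g t → decide g t fresh ≡ nothing → proj₁ t ≡ many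
decide-nothing g (none , none , none) ()
decide-nothing g (none , none , one ) ()
decide-nothing g (none , none , many) ()
decide-nothing g (none , one  , c   ) ()
decide-nothing g (none , many , c   ) ()
decide-nothing g (one  , none , none) ()
decide-nothing g (one  , none , one ) ()
decide-nothing g (one  , none , many) ()
decide-nothing g (one  , one  , c   ) ()
decide-nothing g (one  , many , c   ) ()
decide-nothing g (many , b    , c   ) eq = refl

rule-labels : ∀ {g t ℓ g′} → Rule g t ℓ g′ → ℓ ≢ fresh
rule-labels cherry    ()
rule-labels match     ()
rule-labels (relay _) ()
rule-labels isolated  ()
rule-labels hang      ()

module Peel {n : ℕ} (G : Graph n) where
  open Graph G
  open Game G

  Labelling : Set
  Labelling = Fin n → Label

  marked : Labelling → Label → Fin n → Fin n → Bool
  marked L a u v = adj u v ∧ is a (L v)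

  marked⁻ : ∀ L {a u v} → marked L a u v ≡ true → v ~ u × L v ≡ a
  marked⁻ L {a} {u} {v} p with adj u v in eq
  ... | true = ~-sym eq , does-true (L v ≟ᴸ a) p

  marked⁺ : ∀ L {a u v} → v ~ u → L v ≡ a → marked L a u v ≡ true
  marked⁺ L {a} {u} {v} v~u Lv≡a rewrite ~-sym v~u = dec-true (L v ≟ᴸ a) Lv≡a

  tallyAt : Labelling → Fin n → Tally
  tallyAt L u = tally (marked L fresh u) , tally (marked L needy u) , tally (marked L flexible u)

  -- The rank is the time of labelling, later than all of these for fresh vertices.
  module Structure (L : Labelling) (rank : Fin n → ℕ) where

    -- The first argument is the child. As fresh vertices have the largest rank, a parent may still
    -- be fresh.
    Child : Fin n → Fin n → Set
    Child x y = x ~ y × rank x < rank y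

    ChildWith : Label → Fin n → Fin n → Set
    ChildWith a y x = Child x y × L x ≡ a

    Role : Fin n → Label → Set
    Role y fresh    = ⊤
    Role y matched  = Counts one (ChildWith needy y)
    Role y needy    = Counts none (ChildWith needy y) × Counts none (ChildWith flexible y)
    Role y flexible = Counts many (ChildWith needy y)
                    ⊎ (Counts none (ChildWith needy y) × ∃ (ChildWith flexible y))

    -- A fresh vertex may already have two needy children; it counts as an obstacle only once it is
    -- labelled itself.
    data Obstacle (x : Fin n) : Set where
      cherry : L x ≢ fresh → Counts many (ChildWith needy x) → Obstacle x
      root   : L x ≡ needy → (∀ y → ¬ Child x y) → Obstacle x

    obstacle-labelled : ∀ {x} → Obstacle x → L x ≢ fresh
    obstacle-labelled (cherry Lx≢fresh _) = Lx≢fresh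
    obstacle-labelled (root Lx≡needy _) eq = contradiction (trans (sym eq) Lx≡needy) λ ()

  -- The invariant of the peeling. `parent-unique` records that a vertex had at most one fresh
  -- neighbour when it was labelled.
  record Peeling (L : Labelling) (g : Few) : Set where
    field
      size : ℕ
      rank : Fin n → ℕ
    open Structure L rank public
    field
      rank-labelled  : ∀ {x} → L x ≢ fresh → rank x < size
      rank-fresh     : ∀ {x} → L x ≡ fresh → rank x ≡ size
      rank-injective : ∀ {x y} → L x ≢ fresh → rank x ≡ rank y → x ≡ y
      parent-unique  : ∀ {x y y′} → L x ≢ fresh → Child x y → Child x y′ → y ≡ y′
      role           : ∀ x → Role x (L x)
      obstacles      : Counts g Obstacle

    rank≤size : ∀ x → rank x ≤ size
    rank≤size x with L x ≟ᴸ fresh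
    ... | yes Lx≡fresh = ℕ.≤-reflexive (rank-fresh Lx≡fresh)
    ... | no  Lx≢fresh = ℕ.<⇒≤ (rank-labelled Lx≢fresh)

    below-size : ∀ {x} → rank x < size → L x ≢ fresh
    below-size lt Lx≡fresh = ℕ.<⇒≢ lt (rank-fresh Lx≡fresh)

    child-labelled : ∀ {x y} → Child x y → L x ≢ fresh
    child-labelled {y = y} (_ , lt) = below-size (ℕ.<-≤-trans lt (rank≤size y))

  peeling-start : Peeling (const fresh) none
  peeling-start = record
    { size = 0
    ; rank = const 0
    ; rank-labelled = contradiction refl
    ; rank-fresh = λ _ → refl
    ; rank-injective = contradiction refl
    ; parent-unique = contradiction refl
    ; role = λ _ → tt
    ; obstacles = λ where
        x (Structure.cherry ≢fresh _) → ≢fresh refl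
        x (Structure.root () _)
    }

  -- Labelling one more vertex

  module Extend {L : Labelling} {g : Few} (P : Peeling L g)
           (u : Fin n) (Lu≡fresh : L u ≡ fresh) (few : tally (marked L fresh u) ≢ many)
           (ℓ : Label) (ℓ≢fresh : ℓ ≢ fresh) where
    open Peeling P

    L′ : Labelling
    L′ = updateAt L u (const ℓ)

    -- `u` keeps the rank `size` that it had as a fresh vertex, and the vertices that stay fresh
    -- move up by one.
    rank′ : Fin n → ℕ
    rank′ x = if does (L′ x ≟ᴸ fresh) then suc size else rank x

    module N = Structure L′ rank′

    L′u≡ℓ : L′ u ≡ ℓ
    L′u≡ℓ = updateAt-updates u L

    L′≡L : ∀ {x} → x ≢ u → L′ x ≡ L x
    L′≡L {x} x≢u = updateAt-minimal x u L x≢u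

    labelled-old : ∀ {x} → L x ≢ fresh → L′ x ≡ L x
    labelled-old Lx≢fresh = L′≡L λ { refl → Lx≢fresh Lu≡fresh }

    labelled-mono : ∀ {x} → L x ≢ fresh → L′ x ≢ fresh
    labelled-mono Lx≢fresh = Lx≢fresh ∘ trans (sym (labelled-old Lx≢fresh))

    labelled-new : L′ u ≢ fresh
    labelled-new = ℓ≢fresh ∘ trans (sym L′u≡ℓ)

    fresh-old : ∀ {x} → L′ x ≡ fresh → L x ≡ fresh
    fresh-old {x} eq with L x ≟ᴸ fresh
    ... | yes Lx≡fresh = Lx≡fresh
    ... | no  Lx≢fresh = contradiction eq (labelled-mono Lx≢fresh)

    old-or-new : ∀ {x} → L′ x ≢ fresh → L x ≢ fresh ⊎ x ≡ u
    old-or-new {x} L′x≢fresh with x Fin.≟ u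
    ... | yes x≡u = inj₂ x≡u
    ... | no  x≢u = inj₁ (L′x≢fresh ∘ trans (L′≡L x≢u))

    rank-u : rank u ≡ size
    rank-u = rank-fresh Lu≡fresh

    rank′-labelled : ∀ {x} → L′ x ≢ fresh → rank′ x ≡ rank x
    rank′-labelled {x} L′x≢fresh rewrite dec-false (L′ x ≟ᴸ fresh) L′x≢fresh = refl

    rank′-fresh : ∀ {x} → L′ x ≡ fresh → rank′ x ≡ suc size
    rank′-fresh {x} L′x≡fresh rewrite dec-true (L′ x ≟ᴸ fresh) L′x≡fresh = refl

    rank≤rank′ : ∀ x → rank x ≤ rank′ x
    rank≤rank′ x with L′ x ≟ᴸ fresh
    ... | yes eq = subst (rank x ≤_) (sym (rank′-fresh eq)) (ℕ.m≤n⇒m≤1+n (rank≤size x))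
    ... | no  ≢  = ℕ.≤-reflexive (sym (rank′-labelled ≢))

    rank′<⇒labelled : ∀ {x} → rank′ x ≤ size → L′ x ≢ fresh
    rank′<⇒labelled le eq = ℕ.1+n≰n (subst (_≤ size) (rank′-fresh eq) le)

    child-back : ∀ {x y} → L′ y ≢ fresh → N.Child x y → Child x y
    child-back {x} {y} L′y≢fresh (x~y , lt) = x~y , ℕ.≤-<-trans (rank≤rank′ x)
      (subst (rank′ x <_) (rank′-labelled L′y≢fresh) lt)

    child-forth : ∀ {x y} → L x ≢ fresh → Child x y → N.Child x y
    child-forth {x} {y} Lx≢fresh (x~y , lt) = x~y ,
      subst (_< rank′ y) (sym (rank′-labelled (labelled-mono Lx≢fresh))) (ℕ.<-≤-trans lt (rank≤rank′ y))

    parent-back : ∀ {x y} → L x ≢ fresh → N.Child x y → Child x y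
    parent-back {x} {y} Lx≢fresh child@(x~y , _) with L′ y ≟ᴸ fresh
    ... | no  L′y≢fresh = child-back L′y≢fresh child
    ... | yes L′y≡fresh = x~y ,
          subst (rank x <_) (sym (rank-fresh (fresh-old L′y≡fresh))) (rank-labelled Lx≢fresh)

    -- A labelled vertex neither gains nor loses children: the only new child relations lead from
    -- `u` to vertices that are still fresh.
    with-back : ∀ {a y} → L′ y ≢ fresh → ∀ x → N.ChildWith a y x → ChildWith a y x
    with-back L′y≢fresh x (child , eq) =
      let child′ = child-back L′y≢fresh child
      in  child′ , trans (sym (labelled-old (child-labelled child′))) eq

    with-forth : ∀ {a y} x → ChildWith a y x → N.ChildWith a y x
    with-forth x (child , eq) =
      child-forth (child-labelled child) child , trans (labelled-old (child-labelled child)) eq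

    counts-forth : ∀ {a y} → L′ y ≢ fresh → ∀ {k} →
                   Counts k (ChildWith a y) → Counts k (N.ChildWith a y)
    counts-forth L′y≢fresh {k} = Counts-resp with-forth (with-back L′y≢fresh) k

    role-forth : ∀ {y} → L′ y ≢ fresh → ∀ a → Role y a → N.Role y a
    role-forth ≢fresh fresh    r = tt
    role-forth ≢fresh matched  r = counts-forth ≢fresh {one} r
    role-forth ≢fresh needy    (r , r′) = counts-forth ≢fresh {none} r , counts-forth ≢fresh {none} r′
    role-forth ≢fresh flexible (inj₁ r) = inj₁ (counts-forth ≢fresh {many} r)
    role-forth ≢fresh flexible (inj₂ (r , x , c)) =
      inj₂ (counts-forth ≢fresh {none} r , x , with-forth x c)

    obstacle-forth : ∀ {x} → Obstacle x → N.Obstacle x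
    obstacle-forth (Structure.cherry Lx≢fresh c) =
      N.cherry (labelled-mono Lx≢fresh) (counts-forth (labelled-mono Lx≢fresh) {many} c)
    obstacle-forth obs@(Structure.root Lx≡needy orphan) =
      N.root (trans (labelled-old (obstacle-labelled obs)) Lx≡needy)
             λ y c → orphan y (parent-back (obstacle-labelled obs) c)

    obstacle-back : ∀ {x} → L x ≢ fresh → N.Obstacle x → Obstacle x
    obstacle-back Lx≢fresh (Structure.cherry L′x≢fresh c) =
      cherry Lx≢fresh (Counts-resp (with-back L′x≢fresh) with-forth many c)
    obstacle-back Lx≢fresh (Structure.root L′x≡needy orphan) =
      root (trans (sym (labelled-old Lx≢fresh)) L′x≡needy) λ y c → orphan y (child-forth Lx≢fresh c)

    -- `u` has rank `size`, above all vertices labelled before, so its labelled neighbours are just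
    -- its children.
    counts-children : ∀ {a k} → a ≢ fresh →
      Counts k (λ v → marked L a u v ≡ true) → Counts k (N.ChildWith a u)
    counts-children {a} {k} a≢fresh c = counts-forth labelled-new {k} (Counts-resp
      (λ v p → let v~u , Lv≡a = marked⁻ L p in
         (v~u , subst (rank v <_) (sym rank-u) (rank-labelled (a≢fresh ∘ trans (sym Lv≡a)))) , Lv≡a)
      (λ v ((v~u , _) , Lv≡a) → marked⁺ L v~u Lv≡a)
      k c)

    -- Labelled neighbours of `u` have smaller rank, which leaves only fresh ones as parents.
    parent-fresh : ∀ {y} → N.Child u y → marked L fresh u y ≡ true
    parent-fresh {y} (u~y , lt) with L′ y ≟ᴸ fresh
    ... | yes L′y≡fresh = marked⁺ L (~-sym u~y) (fresh-old L′y≡fresh)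
    ... | no  L′y≢fresh = contradiction
            (subst (_< rank y) rank-u (proj₂ (child-back L′y≢fresh (u~y , lt))))
            (ℕ.≤⇒≯ (rank≤size y))

    fresh-parent : ∀ {y} → marked L fresh u y ≡ true → N.Child u y
    fresh-parent {y} p with marked⁻ L p
    ... | y~u , Ly≡fresh = ~-sym y~u , ℕ.≤-reflexive
          (trans (cong suc (trans (rank′-labelled labelled-new) rank-u))
                 (sym (rank′-fresh (trans (L′≡L (~⇒≢ y~u)) Ly≡fresh))))

    -- Labels, children and parents of the vertices labelled before persist, so only `u` needs a new
    -- role and can change the number of obstacles.
    peeling-extend : ∀ {g′} → N.Role u ℓ →
      (N.Obstacle u × g′ ≡ one ⊕ g) ⊎ (¬ N.Obstacle u × g′ ≡ g) → Peeling L′ g′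
    peeling-extend {g′} role-u new = record
      { size = suc size
      ; rank = rank′
      ; rank-labelled = λ {x} ≢fresh →
          subst (_< suc size) (sym (rank′-labelled ≢fresh)) (s≤s (rank≤size x))
      ; rank-fresh = rank′-fresh
      ; rank-injective = injective
      ; parent-unique = unique
      ; role = roles
      ; obstacles = counted new
      }
      where
      labelled≤ : ∀ {x} → L′ x ≢ fresh → rank′ x ≤ size
      labelled≤ {x} ≢fresh = subst (_≤ size) (sym (rank′-labelled ≢fresh)) (rank≤size x)

      injective : ∀ {x y} → L′ x ≢ fresh → rank′ x ≡ rank′ y → x ≡ y
      injective {x} {y} x≢ eq with rank′<⇒labelled {y} (subst (_≤ size) eq (labelled≤ x≢))
      ... | y≢ with old-or-new x≢ | old-or-new y≢
                  | trans (sym (rank′-labelled x≢)) (trans eq (rank′-labelled y≢))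
      ...   | inj₁ x-old | _          | eq′ = rank-injective x-old eq′
      ...   | inj₂ _     | inj₁ y-old | eq′ = sym (rank-injective y-old (sym eq′))
      ...   | inj₂ x≡u   | inj₂ y≡u   | _   = trans x≡u (sym y≡u)

      unique : ∀ {x y y′} → L′ x ≢ fresh → N.Child x y → N.Child x y′ → y ≡ y′
      unique x≢ c c′ with old-or-new x≢
      ... | inj₁ x-old = parent-unique x-old (parent-back x-old c) (parent-back x-old c′)
      ... | inj₂ refl  = Counts-≤1 few (Counts-tally (marked L fresh u)) (parent-fresh c) (parent-fresh c′)

      roles : ∀ x → N.Role x (L′ x)
      roles x with x Fin.≟ u
      ... | yes refl = subst (N.Role u) (sym L′u≡ℓ) role-u
      ... | no  x≢u  = subst (N.Role x) (sym (L′≡L x≢u)) (old (L x ≟ᴸ fresh))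
        where
        old : Dec (L x ≡ fresh) → N.Role x (L x)
        old (yes eq)  = subst (N.Role x) (sym eq) tt
        old (no  ≢fr) = role-forth (labelled-mono ≢fr) (L x) (role x)

      counted : (N.Obstacle u × g′ ≡ one ⊕ g) ⊎ (¬ N.Obstacle u × g′ ≡ g) → Counts g′ N.Obstacle
      counted (inj₁ (obs , refl)) = Counts-resp
        (λ { x (inj₁ o) → obstacle-forth o ; x (inj₂ refl) → obs })
        (λ x o → case old-or-new (N.obstacle-labelled o) of λ where
          (inj₁ x-old) → inj₁ (obstacle-back x-old o)
          (inj₂ x≡u)   → inj₂ x≡u)
        (one ⊕ g)
        (Counts-insert (λ o → obstacle-labelled o Lu≡fresh) g obstacles)
      counted (inj₂ (¬obs , refl)) = Counts-resp
        (λ _ → obstacle-forth)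
        (λ x o → case old-or-new (N.obstacle-labelled o) of λ where
          (inj₁ x-old) → obstacle-back x-old o
          (inj₂ refl)  → contradiction o ¬obs)
        g obstacles

  peeling-step : ∀ {L g} → Peeling L g → ∀ u {ℓ g′} →
    decide g (tallyAt L u) (L u) ≡ just (ℓ , g′) → Peeling (updateAt L u (const ℓ)) g′
  peeling-step {L} {g} P u eq with decide-rule g (tallyAt L u) (L u) eq
  ... | Lu≡fresh , few , rule = go rule
      (Counts-tally (marked L fresh u)) (Counts-tally (marked L needy u))
      (Counts-tally (marked L flexible u))
    where
    go : ∀ {f b c ℓ g′} → Rule g (f , b , c) ℓ g′ →
         Counts f (λ v → marked L fresh u v ≡ true) →
         Counts b (λ v → marked L needy u v ≡ true) →
         Counts c (λ v → marked L flexible u v ≡ true) →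
         Peeling (updateAt L u (const ℓ)) g′
    go {ℓ = ℓ} r@cherry cf cb cc = peeling-extend (inj₁ many-needy)
        (inj₁ (Structure.cherry (rule-labels r ∘ trans (sym (updateAt-updates u L))) many-needy , refl))
      where
      open Extend P u Lu≡fresh few ℓ (rule-labels r)
      many-needy = counts-children {needy} {many} (λ ()) cb
    go {ℓ = ℓ} r@match cf cb cc = peeling-extend one-needy (inj₂ (no-obstacle , refl))
      where
      open Extend P u Lu≡fresh few ℓ (rule-labels r)
      one-needy = counts-children {needy} {one} (λ ()) cb
      no-obstacle = λ where
        (Structure.cherry _ c) → one≢many one-needy c
        (Structure.root eq _)  → contradiction (trans (sym (updateAt-updates u L)) eq) λ ()
    go {ℓ = ℓ} r@(relay c≢none) cf cb cc =
        peeling-extend (inj₂ (no-needy , some-flexible c≢none cc)) (inj₂ (no-obstacle , refl))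
      where
      open Extend P u Lu≡fresh few ℓ (rule-labels r)
      no-needy = counts-children {needy} {none} (λ ()) cb
      some-flexible : ∀ {c} → c ≢ none → Counts c (λ v → marked L flexible u v ≡ true) →
                      ∃ (N.ChildWith flexible u)
      some-flexible {none} c≢none cc = contradiction refl c≢none
      some-flexible {one}  _ cc with counts-children {flexible} {one} (λ ()) cc
      ... | x , p , _ = x , p
      some-flexible {many} _ cc with counts-children {flexible} {many} (λ ()) cc
      ... | x , _ , _ , p , _ = x , p
      no-obstacle = λ where
        (Structure.cherry _ c) → none≢many no-needy c
        (Structure.root eq _)  → contradiction (trans (sym (updateAt-updates u L)) eq) λ ()
    go {ℓ = ℓ} r@isolated cf cb cc = peeling-extend
        (counts-children {needy} {none} (λ ()) cb , counts-children {flexible} {none} (λ ()) cc)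
        (inj₁ (Structure.root (updateAt-updates u L) (λ y c → cf y (parent-fresh c)) , refl))
      where open Extend P u Lu≡fresh few ℓ (rule-labels r)
    go {ℓ = ℓ} r@hang (y , p , _) cb cc = peeling-extend
        (no-needy , counts-children {flexible} {none} (λ ()) cc) (inj₂ (no-obstacle , refl))
      where
      open Extend P u Lu≡fresh few ℓ (rule-labels r)
      no-needy = counts-children {needy} {none} (λ ()) cb
      no-obstacle = λ where
        (Structure.cherry _ c)    → none≢many no-needy c
        -- The one fresh neighbour is the parent of `u`.
        (Structure.root _ orphan) → orphan y (fresh-parent p)

-- The outcome of a completely peeled graph

outcome : Few → Outcome
outcome none = 𝓓
outcome one  = 𝓝
outcome many = 𝓢

module Analysis {n : ℕ} (G : Graph n) {L g} (P : Peel.Peeling G L g)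
                (labelled : ∀ x → L x ≢ fresh) where
  open Graph G
  open Game G
  open Peel G
  open Peeling P

  unique-parent : ∀ {x y y′} → Child x y → Child x y′ → y ≡ y′
  unique-parent = parent-unique (labelled _)

  child? : ∀ x y → Dec (Child x y)
  child? x y = (adj x y Bool.≟ true) ×-dec (rank x ℕ.<? rank y)

  role-of : ∀ {x a} → L x ≡ a → Role x a
  role-of {x} eq = subst (Role x) eq (role x)

  label-clash : ∀ {x a b} → a ≢ b → L x ≡ a → L x ≢ b
  label-clash a≢b eq eq′ = a≢b (trans (sym eq) eq′)

  needy-children : ∀ {x y} → L y ≡ needy → Child x y → L x ≡ matched
  needy-children {x} {y} Ly child with L x in Lx
  ... | fresh    = contradiction Lx (labelled x)
  ... | matched  = refl
  ... | needy    = contradiction (child , Lx) (proj₁ (role-of Ly) x)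
  ... | flexible = contradiction (child , Lx) (proj₂ (role-of Ly) x)

  cherry-flexible : ∀ {x} → Counts many (ChildWith needy x) → L x ≡ flexible
  cherry-flexible {x} c with L x in Lx
  ... | fresh    = contradiction Lx (labelled x)
  ... | matched  = contradiction c (one≢many (role-of Lx))
  ... | needy    = contradiction c (none≢many (proj₁ (role-of Lx)))
  ... | flexible = refl

  parent-or-child : ∀ {x y} → x ~ y → Child x y ⊎ Child y x
  parent-or-child {x} {y} x~y with ℕ.<-cmp (rank x) (rank y)
  ... | tri< lt _ _ = inj₁ (x~y , lt)
  ... | tri≈ _ eq _ = contradiction (rank-injective (labelled x) eq) (~⇒≢ x~y)
  ... | tri> _ _ gt = inj₂ (~-sym x~y , gt)

  -- Induction from parents to children: ranks grow towards the parents and stay below `size`.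
  upward : (Q : Fin n → Set) → (∀ x → (∀ y → Child x y → Q y) → Q x) → ∀ x → Q x
  upward Q hyp x = go (size ∸ rank x) x ℕ.≤-refl
    where
    go : ∀ k x → size ∸ rank x ≤ k → Q x
    go zero    x bound = contradiction (ℕ.m∸n≡0⇒m≤n (ℕ.n≤0⇒n≡0 bound))
                                       (ℕ.<⇒≱ (rank-labelled (labelled x)))
    go (suc k) x bound = hyp x λ y (_ , lt) →
      go k y (ℕ.≤-pred (ℕ.≤-trans (ℕ.∸-monoʳ-< lt (rank≤size y)) bound))

  downward : (Q : Fin n → Set) → (∀ x → (∀ y → Child y x → Q y) → Q x) → ∀ x → Q x
  downward Q hyp x = go (suc (rank x)) x ℕ.≤-refl
    where
    go : ∀ k x → rank x < k → Q x
    go (suc k) x lt = hyp x λ y (_ , lt′) → go k y (ℕ.<-≤-trans lt′ (ℕ.≤-pred lt))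

  -- Only o itself may be flexible, which makes the parts below distinct obstacles disjoint.
  data Below (o : Fin n) : Fin n → Set where
    here : Below o o
    up   : ∀ {x y} → Child x y → L x ≢ flexible → Below o y → Below o x

  -- Parents are unique, so there is only one chain to climb.
  below? : ∀ o x → Dec (Below o x)
  below? o = upward _ decide-below
    where
    decide-below : ∀ x → (∀ y → Child x y → Dec (Below o y)) → Dec (Below o x)
    decide-below x rec with x Fin.≟ o
    ... | yes refl = yes here
    ... | no  x≢o with L x ≟ᴸ flexible
    ...   | yes eq = no λ { here → x≢o refl ; (up _ ≢flexible _) → ≢flexible eq }
    ...   | no  ≢flexible with any? (child? x)
    ...     | no orphan = no λ { here → x≢o refl ; (up c _ _) → orphan (_ , c) }
    ...     | yes (y , c) = map′ (up c ≢flexible)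
              (λ { here → contradiction refl x≢o ; (up c′ _ b) → subst (Below o) (unique-parent c′ c) b })
              (rec y c)

  -- The condition under which `o` lies below no vertex but itself.
  Top : Fin n → Set
  Top o = L o ≡ flexible ⊎ (∀ y → ¬ Child o y)

  -- Both chains climb through the same unique parents, and neither continues past a top.
  below-unique : ∀ {o o′ x} → Top o → Top o′ → Below o x → Below o′ x → o ≡ o′
  below-unique t t′ here here = refl
  below-unique (inj₁ eq) t′ here (up c ≢fl b) = contradiction eq ≢fl
  below-unique (inj₂ orphan) t′ here (up c ≢fl b) = contradiction c (orphan _)
  below-unique t (inj₁ eq) (up c ≢fl b) here = contradiction eq ≢fl
  below-unique t (inj₂ orphan) (up c ≢fl b) here = contradiction c (orphan _)
  below-unique t t′ (up c _ b) (up c′ _ b′) =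
    below-unique t t′ b (subst (Below _) (unique-parent c′ c) b′)

  obstacle-top : ∀ {o} → Obstacle o → Top o
  obstacle-top (Structure.cherry _ c)    = inj₁ (cherry-flexible c)
  obstacle-top (Structure.root _ orphan) = inj₂ orphan

  -- Staller's forcing moves below an obstacle

  module Forcing (o : Fin n) where

    -- The vertices used up by the forcing moves: each matched vertex, taken by Staller, and its
    -- needy child, where Dominator has to answer.
    Touched : ℕ → Fin n → Set
    Touched t x = ∃ λ a → rank a < t × L a ≡ matched × (x ≡ a ⊎ ChildWith needy a x)

    -- The position after the matched vertices of rank below t have been played in Below o.
    record Forced (t : ℕ) (pos : Position n) : Set where
      field
        conquered : ∀ {x} → Below o x → L x ≡ matched → rank x < t → Owns staller pos x
        untouched : ∀ {x} → Below o x → ¬ Touched t x → Vacant pos x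
    open Forced

    -- The neighbours of a needy vertex are its children, which are all matched, and its parent if
    -- it has one.
    needy-captured : ∀ {pos b} → Below o b → L b ≡ needy → Owns staller pos b →
      (∀ {x} → Below o x → L x ≡ matched → rank x < rank b → Owns staller pos x) →
      (∀ {y} → Child b y → Owns staller pos y) → Captured pos b
    needy-captured below Lb own children parent u (inj₁ refl) = own
    needy-captured below Lb own children parent u (inj₂ u~b) with parent-or-child u~b
    ... | inj₂ b↑u = parent b↑u
    ... | inj₁ u↑b = children (up u↑b (label-clash (λ ()) Lu) below) Lu (proj₂ u↑b)
      where
      Lu : L u ≡ matched
      Lu = needy-children Lb u↑b

    -- Taking `a` gives Staller the last neighbour of its needy child `b`: the matched children of
    -- `b` have smaller rank and are conquered already. So Dominator must answer at `b`.
    force-one : ∀ {t pos a} → Forced t pos → Below o a → L a ≡ matched → rank a ≡ t →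
      (∀ pos′ → Forced (suc t) pos′ → WinningStrategy G staller staller pos′) →
      WinningStrategy G staller staller pos
    force-one {t} {pos} {a} F below La refl continue with role-of La
    ... | b , (b↑a , Lb) , b-only = move-to a a-vacant (answering (b , b-vacant) respond)
      where
      a-untouched : ¬ Touched t a
      a-untouched (a′ , lt , La′ , inj₁ refl)     = ℕ.<-irrefl refl lt
      a-untouched (a′ , lt , La′ , inj₂ (_ , La′′)) = label-clash {b = matched} (λ ()) La′′ La
      b-untouched : ¬ Touched t b
      b-untouched (a′ , lt , La′ , inj₁ refl)      = label-clash (λ ()) Lb La′
      b-untouched (a′ , lt , La′ , inj₂ (b↑a′ , _)) =
        ℕ.<-irrefl (cong rank (unique-parent b↑a′ b↑a)) lt
      b-below : Below o b
      b-below = up b↑a (label-clash (λ ()) Lb) below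
      a-vacant = untouched F below a-untouched
      b≢a : b ≢ a
      b≢a = ~⇒≢ (proj₁ b↑a)
      b-vacant : Vacant (choose staller a pos) b
      b-vacant = choose-vacant b≢a (untouched F b-below b-untouched)
      respond : ∀ w → Vacant (choose staller a pos) w →
                WinningStrategy G staller staller (choose dominator w (choose staller a pos))
      respond w uw with w Fin.≟ b
      ... | yes refl = continue _ record
        { conquered = λ {x} bx Lx lt → choose-preserves uw (case ℕ.m<1+n⇒m<n∨m≡n lt of λ where
            (inj₁ lt) → choose-preserves a-vacant (conquered F bx Lx lt)
            (inj₂ eq) → subst (Owns staller _) (sym (rank-injective (labelled x) eq))
                          (choose-owns {pos = pos} a))
        ; untouched = λ bx ¬touched →
            choose-vacant (λ { refl → ¬touched (a , ℕ.≤-refl , La , inj₂ (b↑a , Lb)) })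
              (choose-vacant (λ { refl → ¬touched (a , ℕ.≤-refl , La , inj₁ refl) })
                (untouched F bx λ { (a′ , lt , rest) → ¬touched (a′ , ℕ.m≤n⇒m≤1+n lt , rest) }))
        }
      -- Dominator answered elsewhere, so Staller takes `b` and thereby captures it.
      ... | no w≢b = move-to b b-vacant′ (captured-wins b (needy-captured b-below Lb
          (choose-owns {pos = choose dominator w (choose staller a pos)} b)
          (λ bx Lx lt → keep (choose-preserves a-vacant (conquered F bx Lx (ℕ.<-trans lt (proj₂ b↑a)))))
          (λ b↑y → subst (Owns staller _) (unique-parent b↑a b↑y) (keep (choose-owns {pos = pos} a)))))
        where
        b-vacant′ = choose-vacant (w≢b ∘ sym) b-vacant
        keep : ∀ {x} → Owns staller (choose staller a pos) x →
               Owns staller (choose staller b (choose dominator w (choose staller a pos))) x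
        keep = choose-preserves b-vacant′ ∘ choose-preserves uw

    force-all : ∀ {pos} → Forced 0 pos →
      (∀ pos′ → Forced size pos′ → WinningStrategy G staller staller pos′) →
      WinningStrategy G staller staller pos
    force-all F win = go size 0 _ (ℕ.+-identityʳ size) F
      where
      go : ∀ k t pos → k + t ≡ size → Forced t pos → WinningStrategy G staller staller pos
      go zero    t pos refl F = win pos F
      go (suc k) t pos eq   F
        with any? (λ a → below? o a ×-dec (L a ≟ᴸ matched) ×-dec (rank a ℕ.≟ t))
      ... | yes (a , below , La , ra) =
        force-one F below La ra λ pos′ → go k (suc t) pos′ (trans (ℕ.+-suc k t) eq)
      ... | no ∄a = go k (suc t) pos (trans (ℕ.+-suc k t) eq) record
        { conquered = λ bx Lx lt → case ℕ.m<1+n⇒m<n∨m≡n lt of λ where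
            (inj₁ lt) → conquered F bx Lx lt
            (inj₂ eq) → contradiction (_ , bx , Lx , eq) ∄a
        ; untouched = λ bx ¬touched →
            untouched F bx λ { (a′ , lt , rest) → ¬touched (a′ , ℕ.m≤n⇒m≤1+n lt , rest) }
        }

    -- Staller now owns all matched vertices below `o`. Taking a needy root captures it; taking a
    -- cherry leaves each of its needy children one move from capture.
    obstacle-captured : Obstacle o → ∀ pos → Forced size pos → WinningStrategy G staller staller pos
    obstacle-captured (Structure.root Lo orphan) pos F = move-to o vacant-o (captured-wins o
        (needy-captured here Lo (choose-owns {pos = pos} o)
          (λ bx Lx _ → choose-preserves vacant-o (conquered F bx Lx (rank-labelled (labelled _))))
          (λ c → contradiction c (orphan _))))
      where
      vacant-o : Vacant pos o
      vacant-o = untouched F here λ where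
        (_ , _ , La , inj₁ refl)     → label-clash (λ ()) La Lo
        (_ , _ , _  , inj₂ (c , _)) → orphan _ c
    obstacle-captured (Structure.cherry _ needy-many@(x , y , x≢y , cx , cy)) pos F =
        move-to o vacant-o (answering (x , choose-vacant (~⇒≢ (proj₁ (proj₁ cx))) (vacant-child cx)) respond)
      where
      Lo : L o ≡ flexible
      Lo = cherry-flexible needy-many
      vacant-o : Vacant pos o
      vacant-o = untouched F here λ where
        (_ , _ , La , inj₁ refl)     → label-clash (λ ()) La Lo
        (_ , _ , _  , inj₂ (_ , Lo′)) → label-clash (λ ()) Lo′ Lo
      below-child : ∀ {z} → ChildWith needy o z → Below o z
      below-child (c , Lz) = up c (label-clash (λ ()) Lz) here
      vacant-child : ∀ {z} → ChildWith needy o z → Vacant pos z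
      vacant-child cz@(c , Lz) = untouched F (below-child cz) λ where
        (_ , _ , La , inj₁ refl)      → label-clash (λ ()) La Lz
        (_ , _ , La , inj₂ (c′ , _)) → label-clash (λ ()) La (trans (cong L (unique-parent c′ c)) Lo)
      module _ (w : Fin n) (uw : Vacant (choose staller o pos) w) where
        capture : ∀ {z} → ChildWith needy o z → z ≢ w →
                  WinningStrategy G staller staller (choose dominator w (choose staller o pos))
        capture {z} cz@(c , Lz) z≢w = move-to z vacant-z (captured-wins z
            (needy-captured (below-child cz) Lz
              (choose-owns {pos = choose dominator w (choose staller o pos)} z)
              (λ bx Lx _ → keep (choose-preserves vacant-o (conquered F bx Lx (rank-labelled (labelled _)))))
              (λ z↑y → subst (Owns staller _) (unique-parent c z↑y) (keep (choose-owns {pos = pos} o)))))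
          where
          vacant-z = choose-vacant z≢w (choose-vacant (~⇒≢ (proj₁ c)) (vacant-child cz))
          keep : ∀ {x} → Owns staller (choose staller o pos) x →
                 Owns staller (choose staller z (choose dominator w (choose staller o pos))) x
          keep = choose-preserves vacant-z ∘ choose-preserves uw

        respond : WinningStrategy G staller staller (choose dominator w (choose staller o pos))
        respond with x Fin.≟ w
        ... | no  x≢w  = capture cx x≢w
        ... | yes refl = capture cy (x≢y ∘ sym)

  obstacle-wins : ∀ {o} → Obstacle o → ∀ pos → (∀ x → Below o x → Vacant pos x) →
                  WinningStrategy G staller staller pos
  obstacle-wins {o} obs pos vacant-below = force-all
      record { conquered = λ _ _ () ; untouched = λ bx _ → vacant-below _ bx } (obstacle-captured obs)
    where open Forcing o

  staller-first : ∃ Obstacle → WinningStrategy G staller staller start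
  staller-first (o , obs) = obstacle-wins obs start λ x _ → start-vacant x

  staller-second : Counts many Obstacle → WinningStrategy G staller dominator start
  staller-second (o , o′ , o≢o′ , obs , obs′) = answering (o , start-vacant o) λ w _ →
    case below? o w of λ where
      (no  ¬b) → obstacle-wins obs _ λ x b → choose-vacant (λ { refl → ¬b b }) (start-vacant x)
      (yes b)  → obstacle-wins obs′ _ λ x b′ → choose-vacant
        (λ { refl → o≢o′ (below-unique (obstacle-top obs) (obstacle-top obs′) b b′) }) (start-vacant x)

  -- Distance from the top of a path of flexible vertices: these are paired from the top, as
  -- only the vertex next to the obstacle, which dominates it, may remain unpaired.
  data Parity (x : Fin n) : Bool → Set where
    last : (∀ y → Child x y → L y ≢ flexible) → Parity x false
    next : ∀ {y p} → Child x y → L y ≡ flexible → Parity y p → Parity x (not p)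

  parity-total : ∀ x → ∃ (Parity x)
  parity-total = upward _ λ x rec → case any? (λ y → child? x y ×-dec (L y ≟ᴸ flexible)) of λ where
    (yes (y , c , Ly)) → let p , py = rec y c in not p , next c Ly py
    (no ∄y)            → false , last λ y c Ly → ∄y (y , c , Ly)

  parity-unique : ∀ {x p q} → Parity x p → Parity x q → p ≡ q
  parity-unique (last _)       (last _)       = refl
  parity-unique (last ∄y)      (next c Ly _)  = contradiction Ly (∄y _ c)
  parity-unique (next c Ly _)  (last ∄y)      = contradiction Ly (∄y _ c)
  parity-unique (next c Ly py) (next c′ _ py′) with refl ← unique-parent c c′ =
    cong not (parity-unique py py′)

  parity : Fin n → Bool
  parity x = proj₁ (parity-total x)

  parity-child : ∀ {x y} → Child x y → L y ≡ flexible → parity x ≡ not (parity y)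
  parity-child {x} {y} c Ly =
    parity-unique (proj₂ (parity-total x)) (next c Ly (proj₂ (parity-total y)))

  parity-parent : ∀ {x p} → Parity x p → p ≡ true → ∃ λ y → Child x y × L y ≡ flexible
  parity-parent (next c Ly _) _ = _ , c , Ly

  rank-star : ∀ {x y} → Star Child x y → rank x ≤ rank y
  rank-star ε              = ℕ.≤-refl
  rank-star ((_ , lt) ◅ s) = ℕ.≤-trans (ℕ.<⇒≤ lt) (rank-star s)

  -- Upward paths from one vertex follow unique parents, so one is an initial segment of the other.
  star-linear : ∀ {c x y} → Star Child c x → Star Child c y → Star Child x y ⊎ Star Child y x
  star-linear ε       t        = inj₁ t
  star-linear (c ◅ s) ε        = inj₂ (c ◅ s)
  star-linear (c ◅ s) (c′ ◅ t) with refl ← unique-parent c c′ = star-linear s t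

  -- Descending through flexible children must stop, and it stops at a vertex with two needy
  -- children.
  flexible-source : ∀ x → L x ≡ flexible → ∃ λ o → Obstacle o × Star Child o x
  flexible-source = downward _ λ x rec Lx → case role-of Lx of λ where
    (inj₁ needy-many)         → x , cherry (labelled x) needy-many , ε
    (inj₂ (_ , y , c , Ly)) → let o , obs , s = rec y c Ly in o , obs , s ◅◅ c ◅ ε

  -- Dominator's pairing in the case of at most one obstacle

  module OneObstacle (obstacle-unique : ∀ {o o′} → Obstacle o → Obstacle o′ → o ≡ o′) where

    -- Both children lie on the upward path from the only obstacle, and on a path two vertices with
    -- the same parent coincide.
    flexible-child-unique : ∀ {x x′ y} → ChildWith flexible y x → ChildWith flexible y x′ → x ≡ x′
    flexible-child-unique {x} {x′} {y} (c , Lx) (c′ , Lx′)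
      with flexible-source x Lx | flexible-source x′ Lx′
    ... | o , obs , s | o′ , obs′ , s′ with refl ← obstacle-unique obs obs′ =
      case star-linear s s′ of λ where
        (inj₁ t) → ascend c c′ t
        (inj₂ t) → sym (ascend c′ c t)
      where
      ascend : ∀ {x x′} → Child x y → Child x′ y → Star Child x x′ → x ≡ x′
      ascend c c′ ε = refl
      -- `y` would lie on the path from `x` to `x′`, although its rank exceeds that of its child
      -- `x′`.
      ascend c c′ (d ◅ t) with refl ← unique-parent c d =
        contradiction (ℕ.≤-<-trans (rank-star t) (proj₂ c′)) (ℕ.<-irrefl refl)

    -- Pairs directed from child to parent. Parity `true` is an odd distance from the top: such a
    -- flexible vertex goes with its flexible parent.
    Down : Fin n → Fin n → Set
    Down x y = Child x y × ((L x ≡ needy × L y ≡ matched)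
                          ⊎ (L x ≡ flexible × L y ≡ flexible × parity x ≡ true))

    down? : ∀ x y → Dec (Down x y)
    down? x y = child? x y ×-dec (((L x ≟ᴸ needy) ×-dec (L y ≟ᴸ matched))
      ⊎-dec ((L x ≟ᴸ flexible) ×-dec (L y ≟ᴸ flexible) ×-dec (parity x Bool.≟ true)))

    Pair : Fin n → Fin n → Set
    Pair x y = Down x y ⊎ Down y x

    -- Parity alternates along flexible vertices; the labels exclude the other cases.
    down-once : ∀ {x y z} → Down x y → ¬ Down z x
    down-once (_ , inj₁ (Lx , _)) (_ , inj₁ (_ , Lx′)) = label-clash (λ ()) Lx Lx′
    down-once (_ , inj₁ (Lx , _)) (_ , inj₂ (_ , Lx′ , _)) = label-clash (λ ()) Lx Lx′
    down-once (_ , inj₂ (Lx , _)) (_ , inj₁ (_ , Lx′)) = label-clash (λ ()) Lx Lx′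
    down-once (_ , inj₂ (_ , _ , px)) (c , inj₂ (_ , Lx , pz)) =
      contradiction (trans (sym pz) (trans (parity-child c Lx) (cong not px))) λ ()

    down-injective : ∀ {x x′ y} → Down x y → Down x′ y → x ≡ x′
    down-injective (c , inj₁ (Lx , Ly)) (c′ , inj₁ (Lx′ , _)) =
      let _ , _ , only = role-of Ly in trans (only _ (c , Lx)) (sym (only _ (c′ , Lx′)))
    down-injective (_ , inj₁ (_ , Ly)) (_ , inj₂ (_ , Ly′ , _)) =
      contradiction Ly′ (label-clash (λ ()) Ly)
    down-injective (_ , inj₂ (_ , Ly , _)) (_ , inj₁ (_ , Ly′)) =
      contradiction Ly′ (label-clash (λ ()) Ly)
    down-injective (c , inj₂ (Lx , _)) (c′ , inj₂ (Lx′ , _)) =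
      flexible-child-unique (c , Lx) (c′ , Lx′)

    pair-unique : ∀ {x y y′} → Pair x y → Pair x y′ → y ≡ y′
    pair-unique (inj₁ (c , _)) (inj₁ (c′ , _)) = unique-parent c c′
    pair-unique (inj₁ d)       (inj₂ d′)       = contradiction d′ (down-once d)
    pair-unique (inj₂ d)       (inj₁ d′)       = contradiction d (down-once d′)
    pair-unique (inj₂ d)       (inj₂ d′)       = down-injective d d′

    open Pairing Pair (λ x y → down? x y ⊎-dec down? y x) swap pair-unique

    module _ (pos : Position n)
             (unspoiled : ∀ x → Owns dominator pos x ⊎ Vacant pos x)
             (defused : ∀ {o} → Obstacle o → Owns dominator pos o) where

      safe-pair : ∀ {x y} → Pair x y → x ~ y → Safe pos x
      safe-pair {x} {y} pair x~y with unspoiled x | unspoiled y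
      ... | inj₁ own | _        = dominated x own (inj₁ refl)
      ... | inj₂ _   | inj₁ own = dominated y own (inj₂ (~-sym x~y))
      ... | inj₂ ux  | inj₂ uy  = paired y pair (~-sym x~y) ux uy

      safe : ∀ x → Safe pos x
      safe x with L x in Lx
      ... | fresh = contradiction Lx (labelled x)
      ... | matched = let y , (c , Ly) , _ = role-of Lx in
        safe-pair (inj₂ (c , inj₁ (Ly , Lx))) (~-sym (proj₁ c))
      ... | needy with any? (child? x)
      ...   | no orphan = dominated x (defused (root Lx λ y c → orphan (y , c))) (inj₁ refl)
      ...   | yes (y , c) with L y in Ly
      ...     | fresh = contradiction Ly (labelled y)
      ...     | matched = safe-pair (inj₁ (c , inj₁ (Lx , Ly))) (proj₁ c)
      ...     | needy = contradiction (c , Lx) (proj₁ (role-of Ly) x)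
      -- A flexible parent with a needy child has two of them; so it is an obstacle, owned by
      -- Dominator, and dominates `x`.
      ...     | flexible with role-of Ly
      ...       | inj₁ needy-many =
        dominated y (defused (cherry (labelled y) needy-many)) (inj₂ (~-sym (proj₁ c)))
      ...       | inj₂ (no-needy , _) = contradiction (c , Lx) (no-needy x)
      safe x | flexible with role-of Lx
      ... | inj₁ needy-many = dominated x (defused (cherry (labelled x) needy-many)) (inj₁ refl)
      ... | inj₂ (_ , y , c , Ly) with parity x in px
      ...   | true  = let z , d , Lz = parity-parent (proj₂ (parity-total x)) px in
        safe-pair (inj₁ (d , inj₂ (Lx , Lz , px))) (proj₁ d)
      -- Here the flexible child `y` has parity `true` and is paired with `x`.
      ...   | false = safe-pair
        (inj₂ (c , inj₂ (Ly , Lx , trans (parity-child c Lx) (cong not px)))) (~-sym (proj₁ c))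

  dominator-wins : Counts none Obstacle → ∀ first → WinningStrategy G dominator first start
  dominator-wins ∄obs = λ where
      dominator → safe-wins-first start all-safe
      staller   → safe-wins start all-safe
    where
    open OneObstacle (λ obs _ → contradiction obs (∄obs _))
    open Pairing Pair (λ x y → down? x y ⊎-dec down? y x) swap pair-unique
    all-safe = safe start (λ x → inj₂ (start-vacant x)) (λ obs → contradiction obs (∄obs _))

  dominator-first : Counts one Obstacle → WinningStrategy G dominator dominator start
  dominator-first (o , obs , only) = move-to o (start-vacant o) (safe-wins _ (safe _ unspoiled
      (λ obs′ → subst (Owns dominator _) (sym (only _ obs′)) (choose-owns {pos = start} o))))
    where
    open OneObstacle (λ obs obs′ → trans (only _ obs) (sym (only _ obs′)))
    open Pairing Pair (λ x y → down? x y ⊎-dec down? y x) swap pair-unique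
    unspoiled : ∀ x → Owns dominator (choose dominator o start) x ⊎ Vacant (choose dominator o start) x
    unspoiled x with x Fin.≟ o
    ... | yes refl = inj₁ (choose-owns {pos = start} x)
    ... | no  x≢o  = inj₂ (choose-vacant x≢o (start-vacant x))

  has-outcome : HasOutcome G (outcome g)
  has-outcome = go g obstacles
    where
    go : ∀ k → Counts k Obstacle → HasOutcome G (outcome k)
    go none c = dominator-wins c
    go one  c dominator = dominator-first c
    go one  (o , obs , _) staller = staller-first (o , obs)
    go many c dominator = staller-second c
    go many (o , _ , _ , obs , _) staller = staller-first (o , obs)

-- A finite graph of minimum degree two has a cycle

module _ {A : Set} where

  lookup-unique : ∀ {xs : List A} → Unique xs → ∀ {i j} → List.lookup xs i ≡ List.lookup xs j → i ≡ j
  lookup-unique (_ ∷ _)     {zero}  {zero}  eq = refl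
  lookup-unique (x∉xs ∷ _)  {zero}  {suc j} eq = contradiction eq (All.lookup x∉xs (∈-lookup j))
  lookup-unique (x∉xs ∷ _)  {suc i} {zero}  eq = contradiction (sym eq) (All.lookup x∉xs (∈-lookup i))
  lookup-unique (_ ∷ xs!)   {suc i} {suc j} eq = cong suc (lookup-unique xs! eq)

  Linked-prefix : ∀ {R : A → A → Set} xs {y ys} → Linked R (xs ++ y ∷ ys) → Linked R (xs ∷ʳ y)
  Linked-prefix []           _       = [-]
  Linked-prefix (x ∷ [])     (r ∷ l) = r ∷ [-]
  Linked-prefix (x ∷ z ∷ xs) (r ∷ l) = r ∷ Linked-prefix (z ∷ xs) l

  Unique-rotate : ∀ xs {y : A} {ys} → Unique (xs ++ y ∷ ys) → Unique (y ∷ xs)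
  Unique-rotate []       _ = [] ∷ []
  Unique-rotate (x ∷ xs) {y} (x∉ ∷ xs!) with Unique-rotate xs xs!
  ... | y∉xs ∷ xs!′ = (All.head (All.++⁻ʳ xs x∉) ∘ sym ∷ y∉xs) ∷ (++⁻ˡ xs x∉ ∷ xs!′)

module Leaf {n : ℕ} (G : Graph n) where
  open Graph G
  open Game G
  open Peel G

  -- The walk ps is listed backwards, so y avoids its first vertex in order not to turn back.
  Forward : Fin n → List (Fin n) → Set
  Forward y ps = ∀ {z zs} → ps ≡ z ∷ zs → y ≢ z

  -- `y` was visited before, though not just before `x`; the stretch of the walk since then closes
  -- up to a cycle with `x` and at least one further vertex.
  close : ∀ {x y ps} → y ~ x → Forward y ps →
          Linked _~_ (x ∷ ps) → Unique (x ∷ ps) → y ∈ ps → ∃ λ v → ∃ (IsCycle G v)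
  close {x} {y} y~x forward linked unique y∈ps with ∈-∃++ y∈ps
  ... | []     , _ , refl = contradiction refl (forward refl)
  ... | z ∷ zs , _ , refl = y , x ∷ z ∷ zs , record
    { closed-walk = y~x ∷ Linked-prefix (x ∷ z ∷ zs) linked
    ; distinct    = Unique-rotate (x ∷ z ∷ zs) unique
    ; long        = s≤s (s≤s z≤n)
    }

  module _ (Q : Fin n → Set)
           (busy : ∀ u → Q u → Counts many (λ v → v ~ u × Q v)) where

    another : ∀ {x} → Q x → ∀ ps → ∃ λ y → y ~ x × Q y × Forward y ps
    another q []       with busy _ q
    ... | y , _ , _ , (y~x , qy) , _ = y , y~x , qy , λ ()
    another q (p ∷ ps) with busy _ q
    ... | y , z , y≢z , (y~x , qy) , (z~x , qz) with y Fin.≟ p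
    ...   | no  y≢p  = y , y~x , qy , λ { refl → y≢p }
    ...   | yes refl = z , z~x , qz , λ { refl → y≢z ∘ sym }

    -- A walk without repetitions has at most `n` vertices, so extending it without turning back
    -- meets an earlier vertex before `k` is used up.
    wander : ∀ k {x} ps → n < k + length (x ∷ ps) → Q x →
             Linked _~_ (x ∷ ps) → Unique (x ∷ ps) → ∃ λ v → ∃ (IsCycle G v)
    wander zero    ps lt q linked unique =
      contradiction (Fin.injective⇒≤ (lookup-unique unique)) (ℕ.<⇒≱ lt)
    wander (suc k) {x} ps lt q linked unique with another q ps
    ... | y , y~x , qy , forward with Any.any? (y Fin.≟_) ps
    ...   | yes y∈ps = close y~x forward linked unique y∈ps
    ...   | no  y∉ps = wander k (x ∷ ps) (subst (n <_) (sym (ℕ.+-suc k _)) lt) qy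
              (y~x ∷ linked) ((~⇒≢ y~x ∷ ¬Any⇒All¬ ps y∉ps) ∷ unique)

    busy⇒cycle : ∃ Q → ∃ λ v → ∃ (IsCycle G v)
    busy⇒cycle (x , q) = wander n [] (ℕ.≤-reflexive (ℕ.+-comm 1 n)) q [-] ([] ∷ [])

  -- When no vertex can be labelled, each fresh one has two fresh neighbours, and walking among
  -- fresh vertices would give a cycle.
  stuck⇒labelled : (∀ v vs → ¬ IsCycle G v vs) → ∀ {L g} →
    (∀ u → decide g (tallyAt L u) (L u) ≡ nothing) → ∀ x → L x ≢ fresh
  stuck⇒labelled acyclic {L} {g} stuck x Lx =
    let v , vs , cycle = busy⇒cycle (λ u → L u ≡ fresh) busy (x , Lx) in acyclic v vs cycle
    where
    busy : ∀ u → L u ≡ fresh → Counts many (λ v → v ~ u × L v ≡ fresh)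
    busy u Lu = Counts-resp (λ v → marked⁻ L) (λ v (v~u , Lv) → marked⁺ L v~u Lv) many
      (subst (λ k → Counts k (λ v → marked L fresh u v ≡ true))
        (decide-nothing g (tallyAt L u) (subst (λ a → decide g (tallyAt L u) a ≡ nothing) Lu (stuck u)))
        (Counts-tally (marked L fresh u)))

-- The machine

finite-× : ∀ {X Y} → Finite X → Finite Y → Finite (X × Y)
finite-× (m , f) (n , g) = m * n , ↔-sym *↔× ↔-∘ (f ×-↔ g)

finite-⊎ : ∀ {X Y} → Finite X → Finite Y → Finite (X ⊎ Y)
finite-⊎ (m , f) (n , g) = m + n , ↔-sym +↔⊎ ↔-∘ (f ⊎-↔ g)

finite-Few : Finite Few
finite-Few = 3 , mk↔ₛ′
  (λ { none → 0F ; one → 1F ; many → 2F })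
  (λ { 0F → none ; 1F → one ; 2F → many })
  (λ { 0F → refl ; 1F → refl ; 2F → refl })
  (λ { none → refl ; one → refl ; many → refl })

-- init  writes fresh labels on both label tapes along the first row;
-- scan  tallies a row and, at its separator, decides on the vertex under the third head;
-- back  returns the second head to the first column after a vertex has been rejected;
-- fwd   moves the third head behind the labels after a vertex has been labelled;
-- copy  copies the third tape to the second one, moving left;
-- rew   returns the first head to the start of the input.
data State : Set where
  init               : State
  copy rew back fwd  : Few → State
  scan               : Few → Tally → State

finite-State : Finite State
finite-State = proj₁ finite , proj₂ finite ↔-∘ mk↔ₛ′
  (λ { init → inj₁ 0F ; (copy g) → inj₂ (inj₁ (0F , g)) ; (rew g) → inj₂ (inj₁ (1F , g))
     ; (back g) → inj₂ (inj₁ (2F , g)) ; (fwd g) → inj₂ (inj₁ (3F , g)) ; (scan g t) → inj₂ (inj₂ (g , t)) })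
  (λ { (inj₁ 0F) → init ; (inj₂ (inj₁ (0F , g))) → copy g ; (inj₂ (inj₁ (1F , g))) → rew g
     ; (inj₂ (inj₁ (2F , g))) → back g ; (inj₂ (inj₁ (3F , g))) → fwd g ; (inj₂ (inj₂ (g , t))) → scan g t })
  (λ { (inj₁ 0F) → refl ; (inj₂ (inj₁ (0F , g))) → refl ; (inj₂ (inj₁ (1F , g))) → refl
     ; (inj₂ (inj₁ (2F , g))) → refl ; (inj₂ (inj₁ (3F , g))) → refl ; (inj₂ (inj₂ (g , t))) → refl })
  (λ { init → refl ; (copy g) → refl ; (rew g) → refl ; (back g) → refl ; (fwd g) → refl
     ; (scan g t) → refl })
  where
  finite : Finite (Fin 1 ⊎ (Fin 4 × Few) ⊎ (Few × Tally))
  finite = finite-⊎ (1 , ↔-id _) (finite-⊎ (finite-× (4 , ↔-id _) finite-Few)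
    (finite-× finite-Few (finite-× finite-Few (finite-× finite-Few finite-Few))))

Cell : Set
Cell = Symbol InputSymbol Label

update : Tally → Bool → Label → Tally
update (f , b , c) e ℓ = f ⊕ indicator (e ∧ is fresh ℓ)
                       , b ⊕ indicator (e ∧ is needy ℓ)
                       , c ⊕ indicator (e ∧ is flexible ℓ)

empty : Tally
empty = none , none , none

Actions : Set
Actions = (State ⊎ Outcome) × Vec (Cell × Direction) 3

-- Kept apart from `transition` so that a step at a separator computes after rewriting with the
-- decision.
judge : Few → Cell → Cell → Cell → Maybe (Label × Few) → Actions
judge g x y z nothing          = inj₁ (back g) , (x , right) ∷ (y , left) ∷ (z , right) ∷ []
judge g x y z (just (ℓ , g′)) = inj₁ (fwd g′) , (x , stay) ∷ (y , stay) ∷ (work ℓ , stay) ∷ []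

transition : State → Vec Cell 3 → Actions
transition init (x@(input (bit _)) ∷ y ∷ z ∷ []) =
  inj₁ init , (x , right) ∷ (work fresh , right) ∷ (work fresh , right) ∷ []
transition init (x ∷ y ∷ z ∷ []) =
  inj₁ (copy none) , (x , stay) ∷ (y , left) ∷ (z , left) ∷ []
transition (copy g) (x ∷ y ∷ z@(work _) ∷ []) =
  inj₁ (copy g) , (x , stay) ∷ (z , left) ∷ (z , left) ∷ []
transition (copy g) (x ∷ y ∷ z ∷ []) =
  inj₁ (rew g) , (x , stay) ∷ (y , stay) ∷ (z , stay) ∷ []
transition (rew g) (x@(input _) ∷ y ∷ z ∷ []) =
  inj₁ (rew g) , (x , left) ∷ (y , stay) ∷ (z , stay) ∷ []
transition (rew g) (x ∷ y ∷ z ∷ []) =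
  inj₁ (scan g empty) , (x , right) ∷ (y , right) ∷ (z , right) ∷ []
transition (scan g t) (x@(input (bit e)) ∷ y@(work ℓ) ∷ z ∷ []) =
  inj₁ (scan g (update t e ℓ)) , (x , right) ∷ (y , right) ∷ (z , stay) ∷ []
transition (scan g t) (x@(input separator) ∷ y ∷ z@(work ℓ) ∷ []) =
  judge g x y z (decide g t ℓ)
transition (scan g t) (x ∷ y ∷ z ∷ []) =
  inj₂ (outcome g) , (x , stay) ∷ (y , stay) ∷ (z , stay) ∷ []
transition (back g) (x ∷ y@(work _) ∷ z ∷ []) =
  inj₁ (back g) , (x , stay) ∷ (y , left) ∷ (z , stay) ∷ []
transition (back g) (x ∷ y ∷ z ∷ []) =
  inj₁ (scan g empty) , (x , stay) ∷ (y , right) ∷ (z , stay) ∷ []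
transition (fwd g) (x ∷ y ∷ z@(work _) ∷ []) =
  inj₁ (fwd g) , (x , stay) ∷ (y , stay) ∷ (z , right) ∷ []
transition (fwd g) (x ∷ y ∷ z ∷ []) =
  inj₁ (copy g) , (x , stay) ∷ (y , left) ∷ (z , left) ∷ []

machine : TuringMachine InputSymbol Outcome
machine = record
  { State = State ; State-finite = finite-State
  ; Work = Label ; Work-finite = 4 , Label↔Fin
  ; extraTapes = 2 ; initial = init ; δ = transition
  }

Config : Set
Config = Configuration machine

Strip : Set
Strip = Tape InputSymbol Label

⟨_∣_,_,_⟩ : State → Strip → Strip → Strip → Config
⟨ q ∣ a , b , c ⟩ = config (inj₁ q) (a ∷ b ∷ c ∷ [])

Reaches : ℕ → Config → Config → Set
Reaches t c c′ = ∃ λ s → s ≤ t × run machine s c ≡ c′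

record HaltsWithin (t : ℕ) (c : Config) (o : Outcome) : Set where
  constructor halted
  field result : Configuration.control (run machine t c) ≡ inj₂ o

stop : ∀ {c} → Reaches 0 c c
stop = 0 , z≤n , refl

infixr 4 _then_

_then_ : ∀ {t c c′ c″} → step machine c ≡ c′ → Reaches t c′ c″ → Reaches (suc t) c c″
refl then (s , s≤t , eq) = suc s , s≤s s≤t , eq

run-+ : ∀ s t c → run machine (s + t) c ≡ run machine t (run machine s c)
run-+ zero    t c = refl
run-+ (suc s) t c = run-+ s t (step machine c)

infixr 4 _⨾_

_⨾_ : ∀ {s t c c′ c″} → Reaches s c c′ → Reaches t c′ c″ → Reaches (s + t) c c″
_⨾_ {c = c} (s , s≤ , refl) (t , t≤ , eq) = s + t , ℕ.+-mono-≤ s≤ t≤ , trans (run-+ s t c) eq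

within : ∀ {s t c c′} → s ≤ t → Reaches s c c′ → Reaches t c c′
within s≤t (r , r≤s , eq) = r , ℕ.≤-trans r≤s s≤t , eq

run-halted : ∀ t {o ts} → run machine t (config (inj₂ o) ts) ≡ config (inj₂ o) ts
run-halted zero    = refl
run-halted (suc t) = run-halted t

halts-mono : ∀ {s t c o} → s ≤ t → HaltsWithin s c o → HaltsWithin t c o
halts-mono {s} {t} {c} {o} s≤t (halted eq) =
  subst (λ r → HaltsWithin r c o) (ℕ.m+[n∸m]≡n s≤t) (halted
    (trans (cong Configuration.control (run-+ s (t ∸ s) c)) (still (run machine s c) eq)))
  where
  still : ∀ c → Configuration.control c ≡ inj₂ o →
          Configuration.control (run machine (t ∸ s) c) ≡ inj₂ o
  still (config _ ts) refl = cong Configuration.control (run-halted (t ∸ s))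

reaches-halts : ∀ {s t c c′ o} → Reaches s c c′ → HaltsWithin t c′ o → HaltsWithin (s + t) c o
reaches-halts {t = t} {c} (r , r≤s , refl) (halted eq) = halts-mono (ℕ.+-monoˡ-≤ t r≤s)
  (halted (trans (cong Configuration.control (run-+ r t c)) eq))

-- Running the machine

-- As in Tape, the first list starts next to the head; the head is on the first cell of the
-- second list, and ls ʳ++ xs is the whole content.
at : List Cell → List Cell → Strip
at ls []       = tape ls blank []
at ls (x ∷ xs) = tape ls x xs

rightwards : ∀ {ls x} xs → shift right (tape ls x xs) ≡ at (x ∷ ls) xs
rightwards []       = refl
rightwards (_ ∷ _)  = refl

inputs : List InputSymbol → List Cell
inputs = List.map input

labels : List Label → List Cell
labels xs = List.map work xs ++ blank ∷ []

inputAt : List InputSymbol → List InputSymbol → Strip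
inputAt ys xs = at (inputs ys ++ blank ∷ []) (inputs xs)

labelsAt : List Label → List Label → Strip
labelsAt ys xs = at (labels ys) (labels xs)

leftwards : ∀ {l ls} xs → shift left (at (l ∷ ls) (labels xs)) ≡ tape ls l (labels xs)
leftwards []       = refl
leftwards (_ ∷ _)  = refl

-- The blank left of the content is listed from the first visit on.
data End : List Cell → Set where
  bare  : End []
  blank : End (blank ∷ [])

leftmost : ∀ {e} → End e → ∀ x xs → shift left (tape e x xs) ≡ at [] (blank ∷ x ∷ xs)
leftmost bare  x xs = refl
leftmost blank x xs = refl

leftmost-labels : ∀ {e} → End e → ∀ xs → shift left (at e (labels xs)) ≡ at [] (blank ∷ labels xs)
leftmost-labels e []       = leftmost e _ _
leftmost-labels e (_ ∷ _)  = leftmost e _ _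

config-cong : ∀ {q a a′ b b′ c c′} → a ≡ a′ → b ≡ b′ → c ≡ c′ → ⟨ q ∣ a , b , c ⟩ ≡ ⟨ q ∣ a′ , b′ , c′ ⟩
config-cong refl refl refl = refl

bits : ∀ {m} → (Fin m → Bool) → List InputSymbol
bits f = tabulate (λ v → bit (f v))

init-loop : ∀ {m} (f : Fin m → Bool) ys rest zs →
  Reaches m ⟨ init ∣ at (inputs ys) (inputs (bits f ++ rest))
                   , at (List.map work zs) [] , at (List.map work zs) [] ⟩
            ⟨ init ∣ at (inputs (bits f ʳ++ ys)) (inputs rest)
                   , at (List.map work (tabulate {n = m} (const fresh) ʳ++ zs)) []
                   , at (List.map work (tabulate {n = m} (const fresh) ʳ++ zs)) [] ⟩
init-loop {zero}  f ys rest zs = stop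
init-loop {suc m} f ys rest zs =
  config-cong (rightwards (inputs (bits (f ∘ suc) ++ rest))) refl refl
  then init-loop (f ∘ suc) (bit (f zero) ∷ ys) rest (fresh ∷ zs)

-- Both heads have to meet the left end together, hence the equal lengths; the old labels `ys′` are
-- overwritten.
copy-loop : ∀ {g x e e′} → End e → End e′ → ∀ ys ys′ zs → length ys ≡ length ys′ →
  Reaches (length ys)
    ⟨ copy g ∣ x , shift left (at (List.map work ys′ ++ e′) (labels zs))
                 , shift left (at (List.map work ys ++ e) (labels zs)) ⟩
    ⟨ copy g ∣ x , at [] (blank ∷ labels (ys ʳ++ zs)) , at [] (blank ∷ labels (ys ʳ++ zs)) ⟩
copy-loop e e′ [] [] zs eq rewrite leftmost-labels e zs | leftmost-labels e′ zs = stop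
copy-loop {e = e} {e′ = e′} e! e′! (y ∷ ys) (y′ ∷ ys′) zs eq
  rewrite leftwards {work y} {List.map work ys ++ e} zs
        | leftwards {work y′} {List.map work ys′ ++ e′} zs =
  refl then copy-loop e! e′! ys ys′ (y ∷ zs) (ℕ.suc-injective eq)

back-loop : ∀ {g x z} ys zs →
  Reaches (length ys) ⟨ back g ∣ x , shift left (labelsAt ys zs) , z ⟩
                      ⟨ back g ∣ x , at [] (blank ∷ labels (ys ʳ++ zs)) , z ⟩
back-loop [] zs rewrite leftmost-labels blank zs = stop
back-loop (y ∷ ys) zs rewrite leftwards {work y} {labels ys} zs =
  refl then back-loop ys (y ∷ zs)

fwd-loop : ∀ {g x y} ys zs →
  Reaches (length zs) ⟨ fwd g ∣ x , y , labelsAt ys zs ⟩ ⟨ fwd g ∣ x , y , labelsAt (zs ʳ++ ys) [] ⟩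
fwd-loop ys []       = stop
fwd-loop ys (z ∷ zs) = config-cong refl refl (rightwards (labels zs)) then fwd-loop (z ∷ ys) zs

rew-loop : ∀ {g a b e} → End e → ∀ ys z zs →
  Reaches (suc (length ys))
    ⟨ rew g ∣ at (inputs ys ++ e) (inputs (z ∷ zs)) , a , b ⟩
    ⟨ rew g ∣ at [] (blank ∷ inputs (ys ʳ++ z ∷ zs)) , a , b ⟩
rew-loop e []       z zs = config-cong (leftmost e _ _) refl refl then stop
rew-loop e (y ∷ ys) z zs = refl then rew-loop e ys y (z ∷ zs)

-- The tally in the order in which the machine accumulates it.
scanRow : ∀ {m} → Tally → (Fin m → Bool) → (Fin m → Label) → Tally
scanRow {zero}  t f L = t
scanRow {suc m} t f L = scanRow (update t (f zero) (L zero)) (f ∘ suc) (L ∘ suc)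

scan-loop : ∀ {m g t z} (f : Fin m → Bool) (L : Fin m → Label) ys rest zs →
  Reaches m ⟨ scan g t ∣ inputAt ys (bits f ++ rest) , labelsAt zs (tabulate L) , z ⟩
            ⟨ scan g (scanRow t f L) ∣ inputAt (bits f ʳ++ ys) rest , labelsAt (tabulate L ʳ++ zs) [] , z ⟩
scan-loop {zero}  f L ys rest zs = stop
scan-loop {suc m} f L ys rest zs =
  config-cong (rightwards (inputs (bits (f ∘ suc) ++ rest))) (rightwards (labels (tabulate (L ∘ suc)))) refl
  then scan-loop (f ∘ suc) (L ∘ suc) (bit (f zero) ∷ ys) rest (L zero ∷ zs)

rowsOf : ∀ {k n} → (Fin k → Fin n → Bool) → List InputSymbol
rowsOf R = concat (tabulate λ u → tabulate (λ v → bit (R u v)) ∷ʳ separator)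

-- One search through the rows of the matrix

module Search {n : ℕ} (L : Fin n → Label) (g : Few) where

  reversed : List Label
  reversed = tabulate L ʳ++ []

  reversed-reversed : reversed ʳ++ [] ≡ tabulate L
  reversed-reversed = reverse-involutive (tabulate L)

  length-reversed : length reversed ≡ n
  length-reversed = trans (length-reverse (tabulate L)) (length-tabulate L)

  verdict : ∀ {k} → (Fin k → Fin n → Bool) → (Fin k → Label) → Fin k → Maybe (Label × Few)
  verdict R self i = decide g (scanRow empty (R i) L) (self i)

  -- Reading the bits, judging at the separator, moving the second head back, and stepping onto the
  -- first label again.
  rowCost : ℕ
  rowCost = n + (1 + (n + 1))

  module _ (f : Fin n → Bool) (x : Label) (ys rest : List InputSymbol) (zs xs : List Label) where

    row-accepted : ∀ {ℓ g′} → decide g (scanRow empty f L) x ≡ just (ℓ , g′) →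
      Reaches (n + 1)
        ⟨ scan g empty ∣ inputAt ys (bits f ++ separator ∷ rest) , labelsAt [] (tabulate L)
                       , labelsAt zs (x ∷ xs) ⟩
        ⟨ fwd g′ ∣ inputAt (bits f ʳ++ ys) (separator ∷ rest) , labelsAt reversed [] , labelsAt zs (ℓ ∷ xs) ⟩
    row-accepted {ℓ} {g′} eq = scan-loop f L ys (separator ∷ rest) [] ⨾ (judged then stop)
      where
      judged : step machine ⟨ scan g (scanRow empty f L)
                ∣ inputAt (bits f ʳ++ ys) (separator ∷ rest) , labelsAt reversed [] , labelsAt zs (x ∷ xs) ⟩
             ≡ ⟨ fwd g′ ∣ inputAt (bits f ʳ++ ys) (separator ∷ rest) , labelsAt reversed []
                        , labelsAt zs (ℓ ∷ xs) ⟩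
      judged rewrite eq = refl

    row-rejected : decide g (scanRow empty f L) x ≡ nothing →
      Reaches rowCost
        ⟨ scan g empty ∣ inputAt ys (bits f ++ separator ∷ rest) , labelsAt [] (tabulate L)
                       , labelsAt zs (x ∷ xs) ⟩
        ⟨ scan g empty ∣ inputAt (separator ∷ (bits f ʳ++ ys)) rest , labelsAt [] (tabulate L)
                       , labelsAt (x ∷ zs) xs ⟩
    row-rejected eq = scan-loop f L ys (separator ∷ rest) [] ⨾ (judged then
      (within (ℕ.≤-reflexive length-reversed) (back-loop reversed []) ⨾
        (config-cong refl (trans (rightwards (labels (reversed ʳ++ [])))
                                 (cong (labelsAt []) reversed-reversed)) refl
         then stop)))
      where
      judged : step machine ⟨ scan g (scanRow empty f L)
                ∣ inputAt (bits f ʳ++ ys) (separator ∷ rest) , labelsAt reversed [] , labelsAt zs (x ∷ xs) ⟩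
             ≡ ⟨ back g ∣ inputAt (separator ∷ (bits f ʳ++ ys)) rest , shift left (labelsAt reversed [])
                        , labelsAt (x ∷ zs) xs ⟩
      judged rewrite eq = config-cong (rightwards (inputs rest)) refl (rightwards (labels xs))

  -- R and self are the rows and labels from the current vertex on, ys and zs the tape
  -- contents before them.
  data Searched {k} (R : Fin k → Fin n → Bool) (self : Fin k → Label)
                (ys : List InputSymbol) (zs : List Label) (c : Config) : Set where
    found : ∀ i {ℓ g′} ys′ x xs zs′ ls → verdict R self i ≡ just (ℓ , g′) →
            ys′ ʳ++ x ∷ xs ≡ ys ʳ++ rowsOf R →
            zs′ ʳ++ ls ≡ zs ʳ++ tabulate (updateAt self i (const ℓ)) →
            Reaches (k * rowCost) c
              ⟨ fwd g′ ∣ inputAt ys′ (x ∷ xs) , labelsAt reversed [] , labelsAt zs′ ls ⟩ →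
            Searched R self ys zs c
    exhausted : (∀ i → verdict R self i ≡ nothing) →
                HaltsWithin (k * rowCost + 1) c (outcome g) → Searched R self ys zs c

  search : ∀ {k} (R : Fin k → Fin n → Bool) (self : Fin k → Label) ys zs →
    Searched R self ys zs
      ⟨ scan g empty ∣ inputAt ys (rowsOf R) , labelsAt [] (tabulate L) , labelsAt zs (tabulate self) ⟩
  -- Behind the last row the first head reads a blank, and the machine halts with the next step.
  search {zero}  R self ys zs = exhausted (λ ()) (halted refl)
  search {suc k} R self ys zs
    rewrite ∷ʳ-++ (bits (R zero)) separator (rowsOf (R ∘ suc)) = by (verdict R self zero) refl
    where
    rest = rowsOf (R ∘ suc)
    row-split : (bits (R zero) ʳ++ ys) ʳ++ separator ∷ rest ≡ ys ʳ++ rowsOf R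
    row-split = trans (ʳ++-ʳ++ (bits (R zero))) (cong (ys ʳ++_) (sym (∷ʳ-++ (bits (R zero)) separator rest)))
    by : ∀ v → verdict R self zero ≡ v → Searched R self ys zs
      ⟨ scan g empty ∣ inputAt ys (bits (R zero) ++ separator ∷ rest) , labelsAt [] (tabulate L)
                     , labelsAt zs (tabulate self) ⟩
    by (just (ℓ , g′)) eq = found zero _ _ _ zs _ eq row-split refl
      (within (ℕ.≤-trans (ℕ.+-monoʳ-≤ n (s≤s z≤n)) (ℕ.m≤m+n rowCost (k * rowCost)))
        (row-accepted (R zero) (self zero) ys rest zs (tabulate (self ∘ suc)) eq))
    by nothing eq
      with search (R ∘ suc) (self ∘ suc) (separator ∷ (bits (R zero) ʳ++ ys)) (self zero ∷ zs)
         | row-rejected (R zero) (self zero) ys rest zs (tabulate (self ∘ suc)) eq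
    ... | found i ys′ x xs zs′ ls eq′ ys-eq zs-eq reaches | rejected =
      found (suc i) ys′ x xs zs′ ls eq′ (trans ys-eq row-split) zs-eq (rejected ⨾ reaches)
    ... | exhausted all-nothing halts | rejected = exhausted
      (λ { zero → eq ; (suc i) → all-nothing i })
      (halts-mono (ℕ.≤-reflexive (sym (ℕ.+-assoc rowCost (k * rowCost) 1))) (reaches-halts rejected halts))

-- Correctness and running time

length-rowsOf : ∀ {k n} (R : Fin k → Fin n → Bool) → length (rowsOf R) ≡ k * suc n
length-rowsOf {zero}  R = refl
length-rowsOf {suc k} {n} R = begin
  length (row ++ rowsOf (R ∘ suc))        ≡⟨ length-++ row ⟩
  length row + length (rowsOf (R ∘ suc))  ≡⟨ cong₂ _+_ length-row (length-rowsOf (R ∘ suc)) ⟩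
  suc n + k * suc n                       ∎
  where
  open ≡-Reasoning
  row = bits (R zero) ∷ʳ separator
  length-row : length row ≡ suc n
  length-row = trans (length-++ (bits (R zero)))
                     (trans (ℕ.+-comm _ 1) (cong suc (length-tabulate _)))

scanRow-tally : ∀ {m} f b c (e : Fin m → Bool) (L : Fin m → Label) →
  scanRow (f , b , c) e L ≡ ( f ⊕ tally (λ v → e v ∧ is fresh (L v))
                            , b ⊕ tally (λ v → e v ∧ is needy (L v))
                            , c ⊕ tally (λ v → e v ∧ is flexible (L v)))
scanRow-tally {zero}  f b c e L =
  sym (cong₂ _,_ (⊕-identityʳ f) (cong₂ _,_ (⊕-identityʳ b) (⊕-identityʳ c)))
scanRow-tally {suc m} f b c e L = trans (scanRow-tally _ _ _ (e ∘ suc) (L ∘ suc))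
  (cong₂ _,_ (⊕-assoc f _ _) (cong₂ _,_ (⊕-assoc b _ _) (⊕-assoc c _ _)))

weight : Label → ℕ
weight fresh    = 1
weight matched  = 0
weight needy    = 0
weight flexible = 0

-- Bounds the number of rounds, since each accepted vertex lowers it by one.
freshCount : ∀ {m} → (Fin m → Label) → ℕ
freshCount {zero}  L = 0
freshCount {suc m} L = weight (L zero) + freshCount (L ∘ suc)

weight-labelled : ∀ {ℓ} → ℓ ≢ fresh → weight ℓ ≡ 0
weight-labelled {fresh}    ℓ≢fresh = contradiction refl ℓ≢fresh
weight-labelled {matched}  _ = refl
weight-labelled {needy}    _ = refl
weight-labelled {flexible} _ = refl

freshCount-start : ∀ m → freshCount {m} (const fresh) ≡ m
freshCount-start zero    = refl
freshCount-start (suc m) = cong suc (freshCount-start m)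

freshCount-update : ∀ {m} (L : Fin m → Label) i {ℓ} → L i ≡ fresh → ℓ ≢ fresh →
                    freshCount L ≡ suc (freshCount (updateAt L i (const ℓ)))
freshCount-update L zero    {ℓ} Li ℓ≢ rewrite Li | weight-labelled ℓ≢ = refl
freshCount-update L (suc i) Li ℓ≢ =
  trans (cong (weight (L zero) +_) (freshCount-update (L ∘ suc) i Li ℓ≢)) (ℕ.+-suc (weight (L zero)) _)

-- (w + 2) (5 w + 3): with n ≤ w, n rounds besides the initialisation and the last search,
-- at a cost of at most 5 w + 3 each.
timeBound : Polynomial
timeBound = 6 ∷ 13 ∷ 5 ∷ []

module Correctness {n : ℕ} (G : Graph n) where
  open Graph G
  open Peel G

  word : List InputSymbol
  word = encode G

  W : ℕ
  W = length word

  W≡ : W ≡ n * suc n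
  W≡ = length-rowsOf adj

  n≤W : n ≤ W
  n≤W = subst (n ≤_) (sym W≡) (ℕ.m≤m*n n (suc n))

  roundStart : Few → Labelling → Config
  roundStart g L = ⟨ scan g empty ∣ inputAt [] word , labelsAt [] (tabulate L) , labelsAt [] (tabulate L) ⟩

  -- Copying the labels, turning, rewinding the input, and stepping onto the first cells.
  restartCost : ℕ
  restartCost = n + (1 + (W + 1))

  -- Used after the initialisation, when the left ends of the tapes are still bare, and after every
  -- relabelling, when they hold a blank.
  restart : ∀ {g e e₁ e₂} → End e → End e₁ → End e₂ → ∀ ys x xs zs₁ zs₂ L →
    ys ʳ++ x ∷ xs ≡ word → zs₂ ʳ++ [] ≡ tabulate L → length zs₁ ≡ n →
    Reaches restartCost
      ⟨ copy g ∣ at (inputs ys ++ e) (inputs (x ∷ xs))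
               , shift left (at (List.map work zs₁ ++ e₁) (labels []))
               , shift left (at (List.map work zs₂ ++ e₂) (labels [])) ⟩
      (roundStart g L)
  restart {g} e! e₁! e₂! ys x xs zs₁ zs₂ L word-eq labels-eq length-eq =
    within (ℕ.+-mono-≤ (ℕ.≤-reflexive length-zs₂) (s≤s (ℕ.+-monoˡ-≤ 1 length-ys)))
      (copy-loop e₂! e₁! zs₂ zs₁ [] (trans length-zs₂ (sym length-eq)) ⨾
       (refl then (rew-loop e! ys x xs ⨾
         (config-cong (trans (rightwards (inputs (ys ʳ++ x ∷ xs))) (cong (inputAt []) word-eq))
                      right-labels right-labels
          then stop))))
    where
    right-labels = trans (rightwards (labels (zs₂ ʳ++ []))) (cong (labelsAt []) labels-eq)
    length-zs₂ : length zs₂ ≡ n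
    length-zs₂ = trans (sym (length-reverse zs₂)) (trans (cong length labels-eq) (length-tabulate L))
    length-ys : suc (length ys) ≤ W
    length-ys = subst (suc (length ys) ≤_)
      (trans (sym (length-ʳ++ ys)) (cong length word-eq))
      (subst (suc (length ys) ≤_) (sym (ℕ.+-suc (length ys) (length xs))) (s≤s (ℕ.m≤m+n _ _)))

  initial≡ : ∀ w → initialConfiguration machine w ≡ ⟨ init ∣ at [] (inputs w) , at [] [] , at [] [] ⟩
  initial≡ []      = refl
  initial≡ (_ ∷ _) = refl

  initialise : 1 ≤ n →
    Reaches (n + (1 + restartCost)) (initialConfiguration machine word) (roundStart none (const fresh))
  -- `n` is a successor, so the input begins with a row, whose `n` bits measure out the fresh
  -- labels.
  initialise (s≤s _) =
    subst (λ c → Reaches (n + (1 + restartCost)) c (roundStart none (const fresh)))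
      (sym (trans (initial≡ word) (cong (λ w → ⟨ init ∣ at [] (inputs w) , at [] [] , at [] [] ⟩) split)))
      (init-loop (adj zero) [] (separator ∷ rest) [] ⨾
       (config-cong (cong (λ ls → at ls (inputs (separator ∷ rest))) (sym (++-identityʳ (inputs firsts))))
                    unpad unpad
        then restart bare bare bare firsts separator rest freshes freshes (const fresh)
               (trans (ʳ++-ʳ++ (bits (adj zero))) (sym split))
               (reverse-involutive (tabulate (const fresh)))
               (trans (length-reverse (tabulate {n = n} (const fresh))) (length-tabulate {n = n} (const fresh)))))
    where
    rest = rowsOf (adj ∘ suc)
    firsts = bits (adj zero) ʳ++ []
    freshes : List Label
    freshes = tabulate {n = n} (const fresh) ʳ++ []
    split : word ≡ bits (adj zero) ++ separator ∷ rest
    split = ∷ʳ-++ (bits (adj zero)) separator rest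
    unpad : shift left (at (List.map work freshes) []) ≡ shift left (at (List.map work freshes ++ []) (labels []))
    unpad = cong (λ ls → shift left (at ls (labels []))) (sym (++-identityʳ (List.map work freshes)))

  relabel : ∀ {g} L L′ ys x xs zs ls → ys ʳ++ x ∷ xs ≡ word → zs ʳ++ ls ≡ tabulate L′ →
    Reaches (n + (1 + restartCost))
      ⟨ fwd g ∣ inputAt ys (x ∷ xs) , labelsAt (tabulate L ʳ++ []) [] , labelsAt zs ls ⟩ (roundStart g L′)
  relabel L L′ ys x xs zs ls word-eq labels-eq =
    within (ℕ.+-monoˡ-≤ (1 + restartCost) length-ls)
      (fwd-loop zs ls ⨾ (refl then
        restart blank blank blank ys x xs (tabulate L ʳ++ []) (ls ʳ++ zs) L′ word-eq
          (trans (ʳ++-ʳ++ ls) (trans (cong (zs ʳ++_) (++-identityʳ ls)) labels-eq))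
          (Search.length-reversed L none)))
    where
    length-ls : length ls ≤ n
    length-ls = subst (length ls ≤_)
      (trans (sym (length-ʳ++ zs)) (trans (cong length labels-eq) (length-tabulate L′)))
      (ℕ.m≤n+m (length ls) (length zs))

  roundCost : ℕ
  roundCost = 5 * W + 3

  setup-bound : n + (1 + restartCost) ≤ 3 * W + 3
  setup-bound = begin
    n + (1 + (n + (1 + (W + 1))))  ≤⟨ ℕ.+-mono-≤ n≤W (s≤s (ℕ.+-monoˡ-≤ (1 + (W + 1)) n≤W)) ⟩
    W + (1 + (W + (1 + (W + 1))))  ≡⟨ solve 1 (λ w →
                                        w :+ (con 1 :+ (w :+ (con 1 :+ (w :+ con 1)))) := con 3 :* w :+ con 3) refl W ⟩
    3 * W + 3                      ∎
    where open ℕ.≤-Reasoning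

  -- There are `n` rows at `2 n + 2` steps each, and the input has `n (n + 1)` symbols.
  search-cost : n * Search.rowCost {n} (const fresh) none ≡ 2 * W
  search-cost = trans
    (solve 1 (λ m → m :* (m :+ (con 1 :+ (m :+ con 1))) := con 2 :* (m :* (con 1 :+ m))) refl n)
    (cong (2 *_) (sym W≡))

  roundCost-split : 2 * W + (3 * W + 3) ≡ roundCost
  roundCost-split = solve 1 (λ w → con 2 :* w :+ (con 3 :* w :+ con 3) := con 5 :* w :+ con 3) refl W

  verdict≡ : ∀ L g u → Search.verdict L g adj L u ≡ decide g (tallyAt L u) (L u)
  verdict≡ L g u = cong (λ t → decide g t (L u)) (scanRow-tally none none none (adj u) L)

  module _ (acyclic : ∀ v vs → ¬ IsCycle G v vs) where

    -- Induction on a bound for the number of fresh vertices. A search either finds a vertex to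
    -- label or shows that the peeling is stuck; then acyclicity leaves no fresh vertex, and the
    -- number of obstacles gives the outcome.
    rounds : ∀ k L g → freshCount L ≤ k → Peeling L g →
      ∃ λ o → HasOutcome G o × HaltsWithin (suc k * roundCost) (roundStart g L) o
    rounds k L g bound P with Search.search L g adj L [] []
    ... | Search.exhausted all-nothing halts = outcome g
      , Analysis.has-outcome G P (Leaf.stuck⇒labelled G acyclic
          (λ u → trans (sym (verdict≡ L g u)) (all-nothing u)))
      , halts-mono (ℕ.≤-trans (ℕ.≤-trans (ℕ.≤-reflexive (cong (_+ 1) search-cost))
            (ℕ.≤-trans (ℕ.+-monoʳ-≤ (2 * W) (ℕ.≤-trans (s≤s z≤n) (ℕ.m≤n+m 3 (3 * W))))
                       (ℕ.≤-reflexive roundCost-split)))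
            (ℕ.m≤m+n roundCost (k * roundCost))) halts
    ... | Search.found i {ℓ} {g′} ys′ x xs zs′ ls accepted ys-eq zs-eq reaches = continue k bound
      where
      L′ = updateAt L i (const ℓ)
      decided : decide g (tallyAt L i) (L i) ≡ just (ℓ , g′)
      decided = trans (sym (verdict≡ L g i)) accepted
      rule = decide-rule g (tallyAt L i) (L i) decided
      decreases : freshCount L ≡ suc (freshCount L′)
      decreases = freshCount-update L i (proj₁ rule) (rule-labels (proj₂ (proj₂ rule)))
      continue : ∀ k → freshCount L ≤ k →
        ∃ λ o → HasOutcome G o × HaltsWithin (suc k * roundCost) (roundStart g L) o
      -- The accepted vertex was fresh, so the bound is positive.
      continue zero    bound = contradiction (subst (_≤ 0) decreases bound) λ ()
      continue (suc k) bound with rounds k L′ g′ (ℕ.≤-pred (subst (_≤ suc k) decreases bound))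
                                         (peeling-step P i decided)
      ... | o , wins , halts = o , wins , reaches-halts
        (within (ℕ.≤-trans (ℕ.+-mono-≤ (ℕ.≤-reflexive search-cost) setup-bound) (ℕ.≤-reflexive roundCost-split))
                (reaches ⨾ relabel L L′ ys′ x xs zs′ ls ys-eq zs-eq))
        halts

    decides : 1 ≤ n → ∃ λ o → HasOutcome G o × OutputsWithin machine (evaluate timeBound W) word o
    decides 1≤n with rounds n (const fresh) none (ℕ.≤-reflexive (freshCount-start n)) peeling-start
    ... | o , wins , halts = o , wins , HaltsWithin.result (halts-mono total
            (reaches-halts (within setup-bound (initialise 1≤n)) halts))
      where
      total : 3 * W + 3 + suc n * roundCost ≤ evaluate timeBound W
      total = begin
        3 * W + 3 + suc n * roundCost
          -- Adding `2 * W` rounds the initialisation up to one more `roundCost`.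
          ≤⟨ ℕ.+-mono-≤ (ℕ.m≤n+m (3 * W + 3) (2 * W)) (ℕ.*-monoˡ-≤ roundCost (s≤s n≤W)) ⟩
        2 * W + (3 * W + 3) + suc W * roundCost
          ≡⟨ solve 1 (λ w → con 2 :* w :+ (con 3 :* w :+ con 3) :+ (con 1 :+ w) :* (con 5 :* w :+ con 3)
                         := con 6 :+ w :* (con 13 :+ w :* (con 5 :+ w :* con 0))) refl W ⟩
        evaluate timeBound W ∎
        where open ℕ.≤-Reasoning

theorem8 : Σ (TuringMachine InputSymbol Outcome) λ M → Σ Polynomial λ p →
    ∀ (n : ℕ) (T : Graph n) → IsTree T →
    ∃ λ (o : Outcome) → HasOutcome T o × OutputsWithin M (evaluate p (length (encode T))) (encode T) o
theorem8 = machine , timeBound , λ n T tree →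
  Correctness.decides T (IsTree.acyclic tree) (IsTree.nonempty tree)
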